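{- Let $m=rn$. The Robinson–Schensted–Knuth correspondence $F\mapsto (P(\sigma_F),Q(\sigma_F))$ is a bijection between $\overline G_r(U,V;d)$ and the set of ordered pairs $(P,Q)$ of standard Young tableaux of equal shape, both belonging to $T([m];d)$ and both satisfying Condition (T): for each $i\in[n]$ and $1\le s<r$, the row containing $r(i-1)+s$ is strictly above the row containing $r(i-1)+s+1$. In particular $g(n;d)$ equals the number of such pairs.
   Context: Fix integers $n,r\ge1$, $m=rn$. $U=\{u_1\prec\cdots\prec u_n\}$, $V=\{v_1\prec\cdots\prec v_n\}$ are disjoint totally ordered sets. An $r$-regular bipartite multigraph on $(U,V)$ is a multiset of edges $uv$ in which every vertex has degree $r$. Edges $uv,u'v'$ are noncrossing if ($u\prec u'$ and $v\prec v'$) or ($u'\prec u$ and $v'\prec v$); a planar matching is a set of pairwise noncrossing edges; $L(G)$ is the maximum size of a planar matching of $G$; $G_r(U,V;d)$ is the set of $r$-regular bipartite multigraphs $G$ on $(U,V)$ with $L(G)\le d$ and $g(n;d)=|G_r(U,V;d)|$. Let $\overline U=U\times[r]$, $\overline V=V\times[r]$, writing $u^s$ for $(u,s)$, ordered lexicographically ($u_i^s\preceq u_j^t$ iff $i<j$, or $i=j$ and $s\le t$; same for $\overline V$), and identified with $[m]$ via $u_i^s\mapsto r(i-1)+s$, $v_i^s\mapsto r(i-1)+s$. An $r$-configuration is a bijection (perfect matching) between $\overline U$ and $\overline V$; it corresponds to the permutation $\sigma_F$ of $[m]$ with $\sigma_F(x)=y$ iff the $x$-th element of $\overline U$ is paired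 with the $y$-th element of $\overline V$. For $G$ an $r$-regular multigraph, its associated configuration $\overline G$ is defined as follows: for each edge $uv$ of $G$ of multiplicity $t\ge1$, let $i$ be the number of edges $uv'$ of $G$ (with multiplicity) with $v\prec v'$ and $j$ the number of edges $u'v$ of $G$ with $u\prec u'$; then $\overline G$ contains the pairs $(u^{i+s},v^{j+t-s+1})$ for $s=1,\dots,t$. $\overline G_r(U,V;d)=\{\overline G: G\in G_r(U,V;d)\}$, and $|\overline G_r(U,V;d)|=g(n;d)$. $T([m];d)$ is the set of standard Young tableaux with entries exactly $1,\dots,m$ and at most $d$ columns (row $i$ is above row $i+1$). For a permutation $\sigma$ of $[m]$, $P(\sigma)$ is the tableau obtained by successively row-inserting (RSK) $\sigma(1),\dots,\sigma(m)$ into the empty tableau, and $Q(\sigma)$ is the recording tableau, having entry $i$ in the box created at the $i$-th insertion. -}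

module Defs where

open import Data.Nat.Properties using (_<?_; +-0-commutativeMonoid)
open import Algebra.Properties.CommutativeMonoid.Sum +-0-commutativeMonoid using (sum-syntax)
open import Data.Bool.Base using (if_then_else_)
open import Data.Fin.Base as Fin using (Fin; toℕ)
open import Data.Fin.Permutation using (Permutation′; _⟨$⟩ʳ_)
import Data.Fin.Properties as Fin
open import Data.List.Base using (List; []; _∷_; [_]; _∷ʳ_; length; map; concat; tabulate; upTo)
open import Data.List.Membership.Propositional using (_∈_)
open import Data.List.Relation.Binary.Permutation.Propositional using (_↭_)
open import Data.List.Relation.Binary.Prefix.Heterogeneous using (Prefix)
open import Data.List.Relation.Unary.All using (All)
open import Data.List.Relation.Unary.AllPairs using (AllPairs)
open import Data.List.Relation.Unary.Any using (Any; index)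
open import Data.List.Relation.Unary.Linked using (Linked)
open import Data.Maybe.Base using (Maybe; just; nothing)
open import Data.Nat.Base using (ℕ; zero; suc; _+_; _*_; _∸_; _≤_; _<_; _>_)
open import Data.Product.Base using (Σ; Σ-syntax; ∃-syntax; _×_; _,_; proj₁; proj₂)
open import Data.Sum.Base using (_⊎_)
open import Function.Bundles using (_↔_; Inverse)
open import Function.Construct.Composition using (_↔-∘_)
open import Function.Construct.Symmetry using (↔-sym)
open import Level using (_⊔_; 0ℓ)
open import Relation.Binary.Bundles using (Setoid)
import Relation.Binary.Construct.On as On
open import Relation.Binary.PropositionalEquality using (_≡_; setoid; _→-setoid_)
open import Relation.Nullary.Decidable using (does; yes; no)

-- The subset of S cut out by P: proofs of P are ignored by the equality.
Subset : ∀ {a ℓ p} (S : Setoid a ℓ) → (Setoid.Carrier S → Set p) → Setoid (a ⊔ p) ℓ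
Subset S P = On.setoid {B = Σ (Setoid.Carrier S) P} S proj₁

HasCardinality : ∀ {a ℓ} → Setoid a ℓ → ℕ → Set (a ⊔ ℓ)
HasCardinality S k = Inverse S (setoid (Fin k))

------------------------------------------------------------------------
-- Bipartite multigraphs

-- Both U and V are labelled by Fin n with its usual order; (u , v) is the
-- edge joining the vertex u of U to the vertex v of V.
Edge : ℕ → Set
Edge n = Fin n × Fin n

-- A multiset of edges, given by its multiplicities.
Multigraph : ℕ → Set
Multigraph n = Edge n → ℕ

degreeᵁ : ∀ {n} → Multigraph n → Fin n → ℕ
degreeᵁ {n} G u = ∑[ v < n ] G (u , v)

degreeⱽ : ∀ {n} → Multigraph n → Fin n → ℕ
degreeⱽ {n} G v = ∑[ u < n ] G (u , v)

record IsRegular {n : ℕ} (r : ℕ) (G : Multigraph n) : Set where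
  field
    regularᵁ : ∀ u → degreeᵁ G u ≡ r
    regularⱽ : ∀ v → degreeⱽ G v ≡ r

NonCrossing : ∀ {n} → Edge n → Edge n → Set
NonCrossing (u , v) (u′ , v′) = (u Fin.< u′ × v Fin.< v′) ⊎ (u′ Fin.< u × v′ Fin.< v)

-- An edge does not satisfy NonCrossing with itself, so the list is
-- duplicate-free and its length is the size of the matching.
record IsPlanarMatching {n : ℕ} (G : Multigraph n) (M : List (Edge n)) : Set where
  field
    edges       : All (λ e → 1 ≤ G e) M
    noncrossing : AllPairs NonCrossing M

-- IsL G ℓ says that ℓ is L(G).
record IsL {n : ℕ} (G : Multigraph n) (ℓ : ℕ) : Set where
  field
    attained : ∃[ M ] (IsPlanarMatching G M × length M ≡ ℓ)
    maximal  : ∀ M → IsPlanarMatching G M → length M ≤ ℓ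

record InG {n : ℕ} (r d : ℕ) (G : Multigraph n) : Set where
  field
    regular : IsRegular r G
    L≤d     : ∃[ ℓ ] (IsL G ℓ × ℓ ≤ d)

𝒢 : (n r d : ℕ) → Setoid 0ℓ 0ℓ
𝒢 n r d = Subset (Edge n →-setoid ℕ) (InG r d)

------------------------------------------------------------------------
-- Configurations

-- (u , p) stands for the copy of u with superscript suc (toℕ p).
Copies : ℕ → ℕ → Set
Copies n r = Fin n × Fin r

Configuration : ℕ → ℕ → Set
Configuration n r = Copies n r ↔ Copies n r

configurationSetoid : (n r : ℕ) → Setoid 0ℓ 0ℓ
configurationSetoid n r = On.setoid {B = Configuration n r} (Copies n r →-setoid Copies n r) Inverse.to

-- *↔× is the lexicographic identification: it matches (i , p) with the
-- element of Fin (n * r) whose value is r * toℕ i + toℕ p.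
σ : ∀ {n r} → Configuration n r → Permutation′ (n * r)
σ {n} {r} F = ↔-sym *↔×′ ↔-∘ (F ↔-∘ *↔×′)
  where *↔×′ = Fin.*↔× {n} {r}

-- F pairs the copy of u with superscript a with the copy of v with
-- superscript b, superscripts being counted from 1.
Contains : ∀ {n r} → Configuration n r → Fin n × ℕ → Fin n × ℕ → Set
Contains {n} {r} F (u , a) (v , b) =
  Σ[ p ∈ Fin r ] Σ[ q ∈ Fin r ]
    (suc (toℕ p) ≡ a × suc (toℕ q) ≡ b × Inverse.to F (u , p) ≡ (v , q))

laterAtᵁ : ∀ {n} → Multigraph n → Edge n → ℕ
laterAtᵁ {n} G (u , v) = ∑[ v′ < n ] (if does (v Fin.<? v′) then G (u , v′) else 0)

laterAtⱽ : ∀ {n} → Multigraph n → Edge n → ℕ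
laterAtⱽ {n} G (u , v) = ∑[ u′ < n ] (if does (u Fin.<? u′) then G (u′ , v) else 0)

-- For an r-regular G, the listed pairs exhaust the n * r copies, so they
-- determine F. The subtraction is not truncated, as s ≤ t.
IsAssociated : ∀ {n r} → Multigraph n → Configuration n r → Set
IsAssociated G F = ∀ u v s →
  let t = G (u , v)
      i = laterAtᵁ G (u , v)
      j = laterAtⱽ G (u , v)
  in 1 ≤ s → s ≤ t → Contains F (u , i + s) (v , j + t ∸ s + 1)

InḠ : ∀ {n r} → ℕ → Configuration n r → Set
InḠ {n} {r} d F = Σ[ G ∈ Multigraph n ] (InG r d G × IsAssociated G F)

𝒢̄ : (n r d : ℕ) → Setoid 0ℓ 0ℓ
𝒢̄ n r d = Subset (configurationSetoid n r) (InḠ d)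

------------------------------------------------------------------------
-- Tableaux

-- The list of rows, from top to bottom.
Tableau : Set
Tableau = List (List ℕ)

shape : Tableau → List ℕ
shape = map length

record IsStandard (m : ℕ) (T : Tableau) : Set where
  field
    nonEmptyRows : All (λ row → 1 ≤ length row) T
    rows         : All (Linked _<_) T
    columns      : Linked (λ upper lower → Prefix _>_ lower upper) T
    entries      : concat T ↭ map suc (upTo m)

record InT (m d : ℕ) (T : Tableau) : Set where
  field
    standard  : IsStandard m T
    columns≤d : All (λ row → length row ≤ d) T

RowStrictlyAbove : Tableau → ℕ → ℕ → Set
RowStrictlyAbove T x y =
  Σ[ p ∈ Any (x ∈_) T ] Σ[ q ∈ Any (y ∈_) T ] (index p Fin.< index q)

ConditionT : (n r : ℕ) → Tableau → Set
ConditionT n r T = (i : Fin n) (s : ℕ) → 1 ≤ s → s < r →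
  RowStrictlyAbove T (r * toℕ i + s) (r * toℕ i + s + 1)

record InPairs (n r d : ℕ) (PQ : Tableau × Tableau) : Set where
  P = PQ .proj₁
  Q = PQ .proj₂
  field
    sameShape  : shape P ≡ shape Q
    P∈T        : InT (n * r) d P
    Q∈T        : InT (n * r) d Q
    conditionP : ConditionT n r P
    conditionQ : ConditionT n r Q

TableauPairs : (n r d : ℕ) → Setoid 0ℓ 0ℓ
TableauPairs n r d = Subset (setoid (Tableau × Tableau)) (InPairs n r d)

------------------------------------------------------------------------
-- The Robinson–Schensted–Knuth correspondence

-- The new row, and the entry bumped out of it, if any.
rowInsert : ℕ → List ℕ → List ℕ × Maybe ℕ
rowInsert x []       = [ x ] , nothing
rowInsert x (y ∷ ys) with x <? y
... | yes _ = x ∷ ys , just y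
... | no  _ = let ys′ , bumped = rowInsert x ys in y ∷ ys′ , bumped

-- The new tableau, and the index (from 0) of the row that gained a box.
insert : ℕ → Tableau → Tableau × ℕ
insert x []        = [ [ x ] ] , 0
insert x (row ∷ T) with rowInsert x row
... | row′ , nothing = row′ ∷ T , 0
... | row′ , just y  = let T′ , k = insert y T in row′ ∷ T′ , suc k

-- Adds a box with entry i at the end of row k. In the recording tableau,
-- k never exceeds the number of rows.
addBox : ℕ → ℕ → Tableau → Tableau
addBox k       i []        = [ [ i ] ]
addBox zero    i (row ∷ T) = (row ∷ʳ i) ∷ T
addBox (suc k) i (row ∷ T) = row ∷ addBox k i T

-- i is the number of the next insertion.
insertWord : ℕ → List ℕ → Tableau × Tableau → Tableau × Tableau
insertWord i []      PQ      = PQ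
insertWord i (x ∷ w) (P , Q) =
  let P′ , k = insert x P in insertWord (suc i) w (P′ , addBox k i Q)

word : ∀ {m} → Permutation′ m → List ℕ
word π = tabulate λ x → suc (toℕ (π ⟨$⟩ʳ x))

-- π ↦ (P(π) , Q(π))
RSK : ∀ {m} → Permutation′ m → Tableau × Tableau
RSK π = insertWord 1 (word π) ([] , [])

{-# OPTIONS --safe #-}

-- Row insertion is invertible and, in a pair (P , Q), the largest entry of Q
-- marks the last box created; hence permutations correspond to pairs of standard
-- tableaux. Under the correspondence
-- * k + 1 lies strictly below k in Q iff σ (k) > σ (k + 1), since a smaller letter
--   is bumped along a path ending strictly lower;
-- * k + 1 lies strictly below k in P iff k + 1 precedes k in the word, since row
--   insertion does not change the relative order of consecutive values in the
--   reading word;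
-- * the length of the first row is that of a longest increasing subsequence.
-- So Condition (T) for Q and P says that σ is decreasing on the copies of each u and
-- σ⁻¹ on those of each v. These configurations are exactly those associated with
-- regular multigraphs: the copies of u are cut into consecutive intervals, one for
-- each v in decreasing order, of length the multiplicity of uv, and similarly for v,
-- and a decreasing bijection between two intervals is the reversal. Moreover an
-- increasing subsequence then uses each u and each v at most once, so it is a
-- planar matching. The length of the first row also decides whether L(G) ≤ d, so
-- the multigraphs can be counted among the finitely many with multiplicities ≤ r.
module Submission where

open import Defs
open import Data.Bool.Base using (Bool; true; false; if_then_else_)
open import Data.Fin.Base as Fin using (Fin; toℕ; fromℕ<; combine; remQuot)
open import Data.Fin.Permutation as Perm using (Permutation′; _⟨$⟩ʳ_; _⟨$⟩ˡ_)
import Data.Fin.Properties as Fin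
open import Data.List.Base hiding (sum)
open import Data.List.Membership.Propositional using (_∈_; _∉_)
import Data.List.Membership.Propositional.Properties as ∈
open import Data.List.Membership.Propositional.Properties.WithK using (unique∧set⇒bag)
open import Data.List.Properties
open import Data.List.Relation.Binary.BagAndSetEquality using (∼bag⇒↭)
open import Data.List.Relation.Binary.Permutation.Propositional
  using (_↭_; prep; ↭-refl; ↭-sym; ↭-trans; ↭-reflexive; ↭⇒↭ₛ; module PermutationReasoning)
import Data.List.Relation.Binary.Permutation.Propositional.Properties as ↭
import Data.List.Relation.Binary.Permutation.Setoid.Properties as ↭ₛ
open import Data.List.Relation.Binary.Prefix.Heterogeneous using (Prefix; []; _∷_; _++ᵖ_)
import Data.List.Relation.Binary.Prefix.Heterogeneous.Properties as Prefix
open import Data.List.Relation.Binary.Sublist.Propositional as Sublist using (_⊆_; []; _∷_; ⊆-trans; from∈; to∈)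
import Data.List.Relation.Binary.Sublist.Propositional.Properties as Sublist
open import Data.List.Relation.Unary.All as All using (All; []; _∷_)
import Data.List.Relation.Unary.All.Properties as All
open import Data.List.Relation.Unary.AllPairs as AllPairs using (AllPairs; []; _∷_)
import Data.List.Relation.Unary.AllPairs.Properties as AllPairs
open import Data.List.Relation.Unary.Any as Any using (Any; here; there; index)
import Data.List.Relation.Unary.Any.Properties as Any
open import Data.List.Relation.Unary.Linked as Linked using (Linked; []; [-]; _∷_)
import Data.List.Relation.Unary.Linked.Properties as Linked
open import Data.List.Relation.Unary.Unique.Propositional using (Unique)
import Data.List.Relation.Unary.Unique.Propositional.Properties as Unique
open import Data.Maybe.Base using (Maybe; just; nothing)
open import Data.Nat.Base hiding (_/_; _%_)
open import Data.Nat.Properties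
open import Algebra.Properties.CommutativeMonoid.Sum +-0-commutativeMonoid
  using (sum; sum-syntax; sum-cong-≗; ∑-comm; ∑-distrib-+; sum-replicate-zero)
open import Data.Product.Base using (Σ; Σ-syntax; ∃; ∃-syntax; ∃₂; _×_; _,_; proj₁; proj₂; uncurry)
import Data.Product.Properties as Product
open import Data.Sum.Base using (_⊎_; inj₁; inj₂)
open import Function.Base using (_∘_; id; flip; case_of_)
open import Function.Bundles using (mk⇔; mk↔ₛ′; Inverse; Bijection)
open import Function.Construct.Composition using (_↔-∘_) renaming (inverse to inverse-∘)
open import Function.Construct.Symmetry using (↔-sym) renaming (inverse to inverse-sym)
open import Function.Properties.Bijection using (Bijection⇒Inverse)
open import Relation.Binary.Definitions using (tri<; tri≈; tri>)
open import Relation.Binary.PropositionalEquality hiding ([_])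
open import Relation.Nullary using (¬_; Dec; yes; no; does; contradiction; _⊎-dec_; _×-dec_; map′)

-- Row insertion and recording

-- The graph of `rowInsert` as an inductive relation, so that proofs follow the insertion path by
-- pattern matching and can also read it backwards from its result.
data RowIns : ℕ → List ℕ → List ℕ → Maybe ℕ → Set where
  end  : ∀ {x} → RowIns x [] [ x ] nothing
  bump : ∀ {x y ys} → x < y → RowIns x (y ∷ ys) (x ∷ ys) (just y)
  skip : ∀ {x y ys ys′ b} → y ≤ x → RowIns x ys ys′ b → RowIns x (y ∷ ys) (y ∷ ys′) b

rowInsert⇒RowIns : ∀ x row → RowIns x row (proj₁ (rowInsert x row)) (proj₂ (rowInsert x row))
rowInsert⇒RowIns x []       = end
rowInsert⇒RowIns x (y ∷ ys) with x <? y
... | yes x<y = bump x<y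
... | no  x≮y = skip (≮⇒≥ x≮y) (rowInsert⇒RowIns x ys)

RowIns⇒rowInsert : ∀ {x row row′ b} → RowIns x row row′ b → rowInsert x row ≡ (row′ , b)
RowIns⇒rowInsert end = refl
RowIns⇒rowInsert {x} (bump {y = y} x<y) with x <? y
... | yes _   = refl
... | no  x≮y = contradiction x<y x≮y
RowIns⇒rowInsert {x} (skip {y = y} y≤x ri) with x <? y
... | yes x<y = contradiction x<y (≤⇒≯ y≤x)
... | no  _   rewrite RowIns⇒rowInsert ri = refl

data Ins : ℕ → Tableau → Tableau → ℕ → Set where
  new  : ∀ {x} → Ins x [] [ [ x ] ] 0
  stop : ∀ {x row row′ T} → RowIns x row row′ nothing → Ins x (row ∷ T) (row′ ∷ T) 0
  bump : ∀ {x y row row′ T T′ k} → RowIns x row row′ (just y) → Ins y T T′ k →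
         Ins x (row ∷ T) (row′ ∷ T′) (suc k)

insert⇒Ins : ∀ x T → Ins x T (proj₁ (insert x T)) (proj₂ (insert x T))
insert⇒Ins x []        = new
insert⇒Ins x (row ∷ T) with rowInsert x row | rowInsert⇒RowIns x row
... | row′ , nothing | ri = stop ri
... | row′ , just y  | ri = bump ri (insert⇒Ins y T)

Ins⇒insert : ∀ {x T T′ k} → Ins x T T′ k → insert x T ≡ (T′ , k)
Ins⇒insert new = refl
Ins⇒insert (stop ri) rewrite RowIns⇒rowInsert ri = refl
Ins⇒insert (bump ri i) rewrite RowIns⇒rowInsert ri | Ins⇒insert i = refl

data Add : ℕ → ℕ → Tableau → Tableau → Set where
  new   : ∀ {i} → Add 0 i [] [ [ i ] ]
  here  : ∀ {i row T} → Add 0 i (row ∷ T) ((row ∷ʳ i) ∷ T)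
  there : ∀ {k i row T T′} → Add k i T T′ → Add (suc k) i (row ∷ T) (row ∷ T′)

Add⇒addBox : ∀ {k i T T′} → Add k i T T′ → addBox k i T ≡ T′
Add⇒addBox new       = refl
Add⇒addBox here      = refl
Add⇒addBox (there a) = cong (_ ∷_) (Add⇒addBox a)

-- The list is the word inserted so far, its latest letter first.
data Run : List ℕ → Tableau → Tableau → Set where
  []   : Run [] [] []
  step : ∀ {x h P P′ Q Q′ k} → Run h P Q → Ins x P P′ k → Add k (suc (length h)) Q Q′ →
         Run (x ∷ h) P′ Q′

-- Insertion preserves tableaux and entries

rowIns-end : ∀ {x r r′} → RowIns x r r′ nothing → r′ ≡ r ∷ʳ x
rowIns-end end         = refl
rowIns-end (skip _ ri) = cong (_ ∷_) (rowIns-end ri)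

rowIns-length : ∀ {x r r′ y} → RowIns x r r′ (just y) → length r ≡ length r′
rowIns-length (bump _)    = refl
rowIns-length (skip _ ri) = cong suc (rowIns-length ri)

rowIns-↭ : ∀ {x r r′ y} → RowIns x r r′ (just y) → x ∷ r ↭ y ∷ r′
rowIns-↭ (bump _)    = _↭_.swap _ _ ↭-refl
rowIns-↭ (skip _ ri) = ↭-trans (_↭_.swap _ _ ↭-refl) (↭-trans (prep _ (rowIns-↭ ri)) (_↭_.swap _ _ ↭-refl))

rowIns-bumped : ∀ {x r r′ y} → RowIns x r r′ (just y) → x < y
rowIns-bumped (bump x<y)  = x<y
rowIns-bumped (skip _ ri) = rowIns-bumped ri

rowIns-∈ : ∀ {x r r′ b} → RowIns x r r′ b → x ∈ r′
rowIns-∈ end         = here refl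
rowIns-∈ (bump _)    = here refl
rowIns-∈ (skip _ ri) = there (rowIns-∈ ri)

rowIns-All : ∀ {p} {P : ℕ → Set p} {x r r′ b} → RowIns x r r′ b → P x → All P r → All P r′
rowIns-All end         px ps       = px ∷ ps
rowIns-All (bump _)    px (_ ∷ ps) = px ∷ ps
rowIns-All (skip _ ri) px (p ∷ ps) = p ∷ rowIns-All ri px ps

rowIns-sorted : ∀ {x r r′ b} → RowIns x r r′ b → AllPairs _≤_ r → AllPairs _≤_ r′
rowIns-sorted end _ = [] ∷ []
rowIns-sorted (bump x<y) (ys ∷ s) = All.map (≤-trans (<⇒≤ x<y)) ys ∷ s
rowIns-sorted (skip y≤x ri) (ys ∷ s) = rowIns-All ri y≤x ys ∷ rowIns-sorted ri s

rowIns-prefix : ∀ {x r r′ b l} → RowIns x r r′ b → Prefix _>_ l r → Prefix _>_ l r′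
rowIns-prefix _           []      = []
rowIns-prefix (bump x<y)  (p ∷ ps) = <-trans x<y p ∷ ps
rowIns-prefix (skip _ ri) (p ∷ ps) = p ∷ rowIns-prefix ri ps

-- The bumped `y` is smaller than whatever stood beneath it, so it lands weakly to the left of its
-- old place. The entries of `u′` up to that place are at most `x`, hence smaller than `y`.
column : ∀ {x u u′ y l l′ b} → RowIns x u u′ (just y) → Prefix _>_ l u → RowIns y l l′ b →
         Prefix _>_ l′ u′
column (bump x<u)    []       end           = x<u ∷ []
column (skip u≤x ri) []       end           = ≤-<-trans u≤x (rowIns-bumped ri) ∷ []
column (bump x<u)    (_ ∷ p)  (bump _)      = x<u ∷ p
column (bump _)      (u<l ∷ _) (skip l≤u _) = contradiction u<l (≤⇒≯ l≤u)
column (skip u≤x ri) (_ ∷ p)  (bump _)      = ≤-<-trans u≤x (rowIns-bumped ri) ∷ rowIns-prefix ri p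
column (skip _ ri)   (u<l ∷ p) (skip _ rj)  = u<l ∷ column ri p rj

data Below (row : List ℕ) : Tableau → Set where
  []  : Below row []
  below : ∀ {lower T} → Prefix _>_ lower row → Below row (lower ∷ T)

-- Rows increase only weakly, so that insertion preserves the property without distinct letters.
-- Strictness comes back from distinct entries in `strict-rows`.
data SSYT : Tableau → Set where
  []   : SSYT []
  cons : ∀ {row T} → 1 ≤ length row → AllPairs _≤_ row → Below row T → SSYT T → SSYT (row ∷ T)

nonempty-∈ : ∀ {x : ℕ} {xs} → x ∈ xs → 1 ≤ length xs
nonempty-∈ (here _)  = s≤s z≤n
nonempty-∈ (there _) = s≤s z≤n

below-rowIns : ∀ {x r r′ b T} → RowIns x r r′ b → Below r T → Below r′ T
below-rowIns ri []    = []
below-rowIns ri (below p) = below (rowIns-prefix ri p)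

below-ins : ∀ {x r r′ y T T′ k} → RowIns x r r′ (just y) → Below r T → Ins y T T′ k → Below r′ T′
below-ins ri _         new         = below (column ri [] end)
below-ins ri (below p) (stop rj)   = below (column ri p rj)
below-ins ri (below p) (bump rj _) = below (column ri p rj)

ins-SSYT : ∀ {x T T′ k} → Ins x T T′ k → SSYT T → SSYT T′
ins-SSYT new _ = cons (s≤s z≤n) ([] ∷ []) [] []
ins-SSYT (stop ri) (cons _ s b t) = cons (nonempty-∈ (rowIns-∈ ri)) (rowIns-sorted ri s) (below-rowIns ri b) t
ins-SSYT (bump ri i) (cons _ s b t) =
  cons (nonempty-∈ (rowIns-∈ ri)) (rowIns-sorted ri s) (below-ins ri b i) (ins-SSYT i t)

ins-↭ : ∀ {x T T′ k} → Ins x T T′ k → x ∷ concat T ↭ concat T′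
ins-↭ new = ↭-refl
ins-↭ {x} (stop {row = row} {T = T} ri) rewrite rowIns-end ri =
  ↭.++⁺ʳ (concat T) (↭.∷↭∷ʳ x row)
ins-↭ {x} (bump {y = y} {row = row} {row′ = row′} {T = T} {T′ = T′} ri i) = begin
  x ∷ row ++ concat T    ↭⟨ ↭.++⁺ʳ (concat T) (rowIns-↭ ri) ⟩
  y ∷ row′ ++ concat T   ↭⟨ ↭.shift y row′ (concat T) ⟨
  row′ ++ y ∷ concat T   ↭⟨ ↭.++⁺ˡ row′ (ins-↭ i) ⟩
  row′ ++ concat T′      ∎
  where open PermutationReasoning

add-↭ : ∀ {i T T′ k} → Add k i T T′ → i ∷ concat T ↭ concat T′
add-↭ new = ↭-refl
add-↭ {i} (here {row = row} {T}) = ↭.++⁺ʳ (concat T) (↭.∷↭∷ʳ i row)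
add-↭ {i} (there {row = row} {T} a) = ↭-trans (↭-sym (↭.shift i row (concat T))) (↭.++⁺ˡ row (add-↭ a))

-- Equal shapes guarantee that `Q` has a place for the box that the insertion created in `P`. This
-- makes the premise `Add` of a `Run` available at each step.
ins-add : ∀ {x P P′ k Q} i → Ins x P P′ k → shape P ≡ shape Q →
          ∃[ Q′ ] (Add k i Q Q′ × shape P′ ≡ shape Q′)
ins-add {Q = []} i new _ = _ , new , refl
ins-add {Q = q ∷ Q} i (stop {x} {row} ri) eq =
  _ , here , cong₂ _∷_
    (trans (cong length (rowIns-end ri)) (trans (length-++-comm row [ x ]) (trans (cong suc (∷-injectiveˡ eq)) (length-++-comm [ i ] q))))
    (∷-injectiveʳ eq)
ins-add {Q = q ∷ Q} i (bump ri j) eq =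
  let Q′ , a , eq′ = ins-add i j (∷-injectiveʳ eq)
  in _ , there a , cong₂ _∷_ (trans (sym (rowIns-length ri)) (∷-injectiveˡ eq)) eq′

run-shape : ∀ {h P Q} → Run h P Q → shape P ≡ shape Q
run-shape [] = refl
run-shape (step r i a) with ins-add _ i (run-shape r)
... | _ , a′ , eq with trans (sym (Add⇒addBox a)) (Add⇒addBox a′)
... | refl = eq

run-insertWord : ∀ w {h P Q} → Run h P Q →
                 let P′ , Q′ = insertWord (suc (length h)) w (P , Q) in Run (w ʳ++ h) P′ Q′
run-insertWord []      r = r
run-insertWord (x ∷ w) {h} {P} {Q} r with ins-add (suc (length h)) (insert⇒Ins x P) (run-shape r)
... | Q′ , a , _ rewrite Add⇒addBox a = run-insertWord w (step r (insert⇒Ins x P) a)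

run-deterministic : ∀ {h P Q P′ Q′} → Run h P Q → Run h P′ Q′ → (P , Q) ≡ (P′ , Q′)
run-deterministic [] [] = refl
run-deterministic (step r i a) (step r′ i′ a′) with run-deterministic r r′
... | refl with trans (sym (Ins⇒insert i)) (Ins⇒insert i′)
... | refl with trans (sym (Add⇒addBox a)) (Add⇒addBox a′)
... | refl = refl

-- The inverse correspondence

-- Reverse bumping: `y` takes the place of the last entry smaller than it, and that entry comes out
-- as `x`. The hypothesis on the head ensures that there is such an entry.
rowUninsert : ∀ {y z zs} → AllPairs _≤_ (z ∷ zs) → z < y →
              ∃₂ λ x u → RowIns x u (z ∷ zs) (just y) × AllPairs _≤_ u
rowUninsert {y} {z} {[]} _ z<y = z , [ y ] , bump z<y , [] ∷ []
rowUninsert {y} {z} {w ∷ ws} (zs ∷ s@(ws′ ∷ s′)) z<y with w <? y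
... | no w≮y = z , y ∷ w ∷ ws , bump z<y , (y≤w ∷ All.map (≤-trans y≤w) ws′) ∷ s
  where y≤w = ≮⇒≥ w≮y
... | yes w<y with rowUninsert s w<y
-- `x ∷ u` rearranges `y ∷ w ∷ ws`, all of whose letters are at least `z`.
... | x , u , ri , su with ↭.All-resp-↭ (↭-sym (rowIns-↭ ri)) (<⇒≤ z<y ∷ zs)
... | z≤x ∷ z≤u = x , z ∷ u , skip z≤x ri , z≤u ∷ su

-- The head of `l′` is at most `y` and lies under the head of `row`, so the latter is smaller than
-- `y`, as `rowUninsert` requires.
rowUninsert-column : ∀ {y l l′ b row} → AllPairs _≤_ row → Prefix _>_ l′ row → RowIns y l l′ b →
                     ∃₂ λ x u → RowIns x u row (just y) × AllPairs _≤_ u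
rowUninsert-column s (q ∷ _) end          = rowUninsert s q
rowUninsert-column s (q ∷ _) (bump _)     = rowUninsert s q
rowUninsert-column s (q ∷ _) (skip l≤y _) = rowUninsert s (<-≤-trans q l≤y)

prefix-unins-above : ∀ {x y u u′ l} → RowIns x u u′ (just y) → All (y <_) l →
                     Prefix _>_ l u′ → Prefix _>_ l u
prefix-unins-above _           _          []      = []
prefix-unins-above (bump _)    (y<l ∷ _)  (_ ∷ p) = y<l ∷ p
prefix-unins-above (skip _ ri) (_ ∷ y<ls) (q ∷ p) = q ∷ prefix-unins-above ri y<ls p

-- `y` itself occurs in `l′`, and would have to lie under an entry of `u`.
no-column-into-larger : ∀ {y l l′ b u} → RowIns y l l′ b → All (y ≤_) u → ¬ Prefix _>_ l′ u
no-column-into-larger end         (y≤u ∷ _)  (u<y ∷ _) = contradiction u<y (≤⇒≯ y≤u)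
no-column-into-larger (bump _)    (y≤u ∷ _)  (u<y ∷ _) = contradiction u<y (≤⇒≯ y≤u)
no-column-into-larger (skip _ ri) (_ ∷ y≤us) (_ ∷ p)   = no-column-into-larger ri y≤us p

-- The converse of `column`, for undoing an insertion. `y` cannot stand in `l′` to the right of its
-- place in `u`, since the entries above would be at least `y`. So the entries of `l` from the place
-- of `y` in `l′` onwards all exceed `y`, and putting `y` back into `u` above them does no harm.
column⁻ : ∀ {x u u′ y l l′ b} → RowIns x u u′ (just y) → RowIns y l l′ b →
          AllPairs _≤_ u → AllPairs _≤_ l → Prefix _>_ l′ u′ → Prefix _>_ l u
column⁻ _           end           _        _        _       = []
column⁻ (bump _)    (bump y<l)    _        _        (_ ∷ p) = y<l ∷ p
column⁻ (skip u≤x ri) (bump y<l)  _        (ls ∷ _) (_ ∷ p) =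
  <-trans (≤-<-trans u≤x (rowIns-bumped ri)) y<l ∷ prefix-unins-above ri (All.map (<-≤-trans y<l) ls) p
column⁻ (bump _)    (skip _ rj)   (us ∷ _) _        (_ ∷ p) = contradiction p (no-column-into-larger rj us)
column⁻ (skip _ ri) (skip _ rj)   (_ ∷ su) (_ ∷ sl) (q ∷ p) = q ∷ column⁻ ri rj su sl p

prefix-init : ∀ {l} r {x : ℕ} → Prefix _>_ l (r ∷ʳ x) → length l ≤ length r → Prefix _>_ l r
prefix-init []      []      _       = []
prefix-init (_ ∷ _) []      _       = []
prefix-init (_ ∷ r) (q ∷ p) (s≤s n) = q ∷ prefix-init r p n

sorted-∷ʳ⁻ : ∀ r {x} → AllPairs _≤_ (r ∷ʳ x) → AllPairs _≤_ r × All (_≤ x) r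
sorted-∷ʳ⁻ []      _       = [] , []
sorted-∷ʳ⁻ (y ∷ r) (q ∷ s) =
  let s′ , q′ = sorted-∷ʳ⁻ r s
  in All.++⁻ˡ r q ∷ s′ , All.head (All.++⁻ʳ r q) ∷ q′

rowIns-all≤ : ∀ {x r} → All (_≤ x) r → RowIns x r (r ∷ʳ x) nothing
rowIns-all≤ []       = end
rowIns-all≤ (p ∷ ps) = skip p (rowIns-all≤ ps)

length-∷ʳ : ∀ r (x : ℕ) → length (r ∷ʳ x) ≡ suc (length r)
length-∷ʳ r x = length-++-comm r [ x ]

-- The box by which `Q` exceeds `Q₀` is a corner of `U`: its entry is taken out and reverse-bumped
-- through the rows above. `SSYT Q₀` ensures that the shape left behind has nonempty rows of weakly
-- decreasing lengths.
uninsert : ∀ {k i Q₀ Q U} → Add k i Q₀ Q → SSYT Q₀ → SSYT U → shape U ≡ shape Q →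
           ∃₂ λ x T → SSYT T × Ins x T U k × shape T ≡ shape Q₀
uninsert {U = (x ∷ []) ∷ []} new [] (cons _ _ _ _) eq = x , [] , [] , new , refl
uninsert {U = row ∷ U} (here {row = row₀}) (cons ne _ b₀ _) (cons _ s b t) eq with initLast row
... | [] = contradiction (trans (∷-injectiveˡ eq) (length-∷ʳ row₀ _)) λ()
... | r ∷ʳ′ x = x , r ∷ U , cons (subst (1 ≤_) (sym len) ne) (proj₁ (sorted-∷ʳ⁻ r s)) (below-init b b₀ (∷-injectiveʳ eq)) t
                  , stop (rowIns-all≤ (proj₂ (sorted-∷ʳ⁻ r s))) , cong₂ _∷_ len (∷-injectiveʳ eq)
  where
  len : length r ≡ length row₀
  len = suc-injective (trans (sym (length-∷ʳ r x)) (trans (∷-injectiveˡ eq) (length-∷ʳ row₀ _)))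
  below-init : ∀ {U Q} → Below (r ∷ʳ x) U → Below row₀ Q → shape U ≡ shape Q → Below r U
  below-init []    []    _  = []
  below-init (below p) (below p₀) e =
    below (prefix-init r p (subst₂ _≤_ (sym (∷-injectiveˡ e)) (sym len) (Prefix.length-mono p₀)))
uninsert {U = row ∷ U} (there a) (cons ne _ _ t₀) (cons _ s b t) eq with uninsert a t₀ t (∷-injectiveʳ eq)
... | y , T , st , i , eqT = let x , u , ri , su , b′ = bumpable s b st i in
    x , u ∷ T
  , cons (subst (1 ≤_) (sym (trans (rowIns-length ri) (∷-injectiveˡ eq))) ne) su b′ st
  , bump ri i , cong₂ _∷_ (trans (rowIns-length ri) (∷-injectiveˡ eq)) eqT
  where
  bumpable : ∀ {row y T U k} → AllPairs _≤_ row → Below row U → SSYT T → Ins y T U k →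
             ∃₂ λ x u → RowIns x u row (just y) × AllPairs _≤_ u × Below u T
  bumpable s (below (q ∷ p)) _ new =
    let x , u , ri , su = rowUninsert s q in x , u , ri , su , []
  bumpable s (below p) (cons _ sl _ _) (stop rj) = 
    let x , u , ri , su = rowUninsert-column s p rj in x , u , ri , su , below (column⁻ ri rj su sl p)
  bumpable s (below p) (cons _ sl _ _) (bump rj _) =
    let x , u , ri , su = rowUninsert-column s p rj in x , u , ri , su , below (column⁻ ri rj su sl p)

-- A maximal entry can be taken at the end of its row, and nothing stands beneath it there because
-- columns increase strictly; so it occupies a corner.
removeMax : ∀ {M Q} → SSYT Q → M ∈ concat Q → All (_≤ M) (concat Q) →
            ∃₂ λ k Q₀ → Add k M Q₀ Q × SSYT Q₀
removeMax {M} {row ∷ Q} (cons ne s b t) M∈ ≤M with ∈.∈-++⁻ row M∈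
... | inj₂ M∈Q =
  let k , Q₀ , a , t₀ = removeMax t M∈Q (All.++⁻ʳ row ≤M)
  in suc k , row ∷ Q₀ , there a , cons ne s (below-remove a b) t₀
  where
  below-remove : ∀ {k i row Q₀ Q} → Add k i Q₀ Q → Below row Q → Below row Q₀
  below-remove new       _         = []
  below-remove (here {row = r}) (below p) = below (prefix-∷ʳ⁻ r p)
    where
    prefix-∷ʳ⁻ : ∀ r {x row} → Prefix _>_ (r ∷ʳ x) row → Prefix _>_ r row
    prefix-∷ʳ⁻ []      _       = []
    prefix-∷ʳ⁻ (_ ∷ r) (q ∷ p) = q ∷ prefix-∷ʳ⁻ r p
  below-remove (there _) (below p) = below p
... | inj₁ M∈row with initLast row
... | [] = contradiction ne λ()
... | r ∷ʳ′ z with ≤-antisym (All.head (All.++⁻ʳ r (All.++⁻ˡ (r ∷ʳ z) ≤M)))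
                              (last-max M∈row)
  where
  last-max : M ∈ r ∷ʳ z → M ≤ z
  last-max m with ∈.∈-++⁻ r m
  ... | inj₁ m∈r         = All.lookup (proj₂ (sorted-∷ʳ⁻ r s)) m∈r
  ... | inj₂ (here refl) = ≤-refl
removeMax {M} {.(r ∷ʳ M) ∷ Q} (cons ne s b t) M∈ ≤M | inj₁ M∈row | r ∷ʳ′ .M | refl =
  finish r (proj₁ (sorted-∷ʳ⁻ r s)) (below-init b (All.++⁻ʳ (r ∷ʳ M) ≤M)) t
  where
  prefix-max : ∀ {l} r → Prefix _>_ l (r ∷ʳ M) → All (_≤ M) l → Prefix _>_ l r
  prefix-max []      []      _           = []
  prefix-max (_ ∷ _) []      _           = []
  prefix-max []      (q ∷ _) (l≤M ∷ _)   = contradiction q (≤⇒≯ l≤M)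
  prefix-max (_ ∷ r) (q ∷ p) (_ ∷ ls≤M)  = q ∷ prefix-max r p ls≤M
  below-init : ∀ {Q} → Below (r ∷ʳ M) Q → All (_≤ M) (concat Q) → Below r Q
  below-init []        _  = []
  below-init (below {lower} p) ≤M = below (prefix-max r p (All.++⁻ˡ lower ≤M))
  finish : ∀ {Q} r → AllPairs _≤_ r → Below r Q → SSYT Q → ∃₂ λ k Q₀ → Add k M Q₀ ((r ∷ʳ M) ∷ Q) × SSYT Q₀
  -- If `M` was alone in its row, the row disappears. No row can follow it, as a row beneath an
  -- empty one would itself be empty.
  finish []      _ []         _              = 0 , [] , new , []
  finish []      _ (below []) (cons () _ _ _)
  finish (z ∷ r) s b          t              = 0 , _ , here , cons (s≤s z≤n) s b t

range : ℕ → List ℕ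
range m = map suc (upTo m)

range-suc : ∀ m → suc m ∷ range m ↭ range (suc m)
range-suc m = ↭-trans (↭.∷↭∷ʳ (suc m) (range m))
  (↭-reflexive (trans (sym (map-++ suc (upTo m) [ m ])) (cong (map suc) (upTo-∷ʳ m))))

range-≤ : ∀ m → All (_≤ m) (range m)
range-≤ m = All.map⁺ (All.applyUpTo⁺₁ id m id)

range-unique : ∀ m → Unique (range m)
range-unique m = Unique.map⁺ suc-injective (Unique.upTo⁺ m)

concat-empty : ∀ {T} → SSYT T → concat T ≡ [] → T ≡ []
concat-empty [] _ = refl
concat-empty (cons {_ ∷ _} _ _ _ _) ()

-- The largest entry of `Q` marks the box created last. `removeMax` takes it out of `Q`, `uninsert`
-- finds the letter whose insertion created that box of `P`, and induction recovers the earlier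
-- letters.
run-surjective : ∀ m {P Q} → SSYT P → SSYT Q → shape P ≡ shape Q → concat Q ↭ range m →
                 ∃[ h ] (length h ≡ m × Run h P Q)
run-surjective zero {P} sP sQ eq Q↭ with concat-empty sQ (↭.↭-empty-inv Q↭)
run-surjective zero {[]} sP sQ eq Q↭ | refl = [] , refl , []
run-surjective (suc m) sP sQ eq Q↭
  with removeMax sQ (↭.∈-resp-↭ (↭-trans (range-suc m) (↭-sym Q↭)) (here refl))
                    (↭.All-resp-↭ (↭-sym Q↭) (range-≤ (suc m)))
... | k , Q₀ , a , sQ₀ with uninsert a sQ₀ sP eq
... | x , T , sT , i , eqT
  with run-surjective m sT sQ₀ eqT (↭.drop-∷ (↭-trans (add-↭ a) (↭-trans Q↭ (↭-sym (range-suc m)))))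
... | h , refl , r = x ∷ h , refl , step r i a

-- The tableaux of a run, and injectivity

run-SSYTˡ : ∀ {h P Q} → Run h P Q → SSYT P
run-SSYTˡ []           = []
run-SSYTˡ (step r i _) = ins-SSYT i (run-SSYTˡ r)

run-↭ˡ : ∀ {h P Q} → Run h P Q → concat P ↭ h
run-↭ˡ []           = ↭-refl
run-↭ˡ (step r i _) = ↭-trans (↭-sym (ins-↭ i)) (prep _ (run-↭ˡ r))

run-↭ʳ : ∀ {h P Q} → Run h P Q → concat Q ↭ range (length h)
run-↭ʳ []                   = ↭-refl
run-↭ʳ (step {h = h} r _ a) =
  ↭-trans (↭-sym (add-↭ a)) (↭-trans (prep _ (run-↭ʳ r)) (range-suc (length h)))

run-<ʳ : ∀ {h P Q} → Run h P Q → All (_< suc (length h)) (concat Q)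
run-<ʳ r = ↭.All-resp-↭ (↭-sym (run-↭ʳ r)) (All.map s≤s (range-≤ _))

prefix-snoc : ∀ {i l u} → Prefix _>_ l u → All (_< i) u → suc (length l) ≤ length u →
              Prefix _>_ (l ∷ʳ i) u
prefix-snoc []      (u<i ∷ _) _       = u<i ∷ []
prefix-snoc (q ∷ p) (_ ∷ us)  (s≤s n) = q ∷ prefix-snoc p us n

-- As `i` exceeds all entries, only the shape could fail. It is the shape of the tableau `P`, whose
-- row lengths show that the new box has a box above it.
add-SSYT : ∀ {k i Q Q′ P} → Add k i Q Q′ → SSYT Q → All (_< i) (concat Q) →
           SSYT P → shape P ≡ shape Q′ → SSYT Q′
add-SSYT new _ _ _ _ = cons (s≤s z≤n) ([] ∷ []) [] []
add-SSYT {i = i} (here {row = row}) (cons ne s b t) <i _ _ =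
  cons (subst (1 ≤_) (sym (length-∷ʳ row i)) (s≤s z≤n))
       (AllPairs.++⁺ s ([] ∷ []) (All.map (λ p → <⇒≤ p ∷ []) (All.++⁻ˡ row <i)))
       (below-++ b) t
  where
  below-++ : ∀ {T} → Below row T → Below (row ∷ʳ i) T
  below-++ []        = []
  below-++ (below p) = below (p ++ᵖ [ i ])
add-SSYT {i = i} {P = row₁ ∷ P} (there {row = row} a) (cons ne s b t) <i (cons _ _ b₁ t₁) eq =
  cons ne s (below-add a b b₁ (∷-injectiveʳ eq)) (add-SSYT a t (All.++⁻ʳ row <i) t₁ (∷-injectiveʳ eq))
  where
  below-add : ∀ {k Q Q′ P} → Add k i Q Q′ → Below row Q → Below row₁ P → shape P ≡ shape Q′ → Below row Q′
  below-add new _ _ _ = below (prefix-snoc [] (All.++⁻ˡ row <i) ne)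
  below-add (here {row = l}) (below p) (below p₁) e = below (prefix-snoc p (All.++⁻ˡ row <i)
    (subst₂ _≤_ (trans (∷-injectiveˡ e) (length-∷ʳ l i)) (∷-injectiveˡ eq) (Prefix.length-mono p₁)))
  below-add (there _) (below p) _ _ = below p

run-SSYTʳ : ∀ {h P Q} → Run h P Q → SSYT Q
run-SSYTʳ [] = []
run-SSYTʳ R@(step r i a) = add-SSYT a (run-SSYTʳ r) (run-<ʳ r) (run-SSYTˡ R) (run-shape R)

-- The letter that replaced `y` is recognised in `r′` as the last entry smaller than `y`.
rowIns-injective : ∀ {x x₂ r r₂ r′ y} → RowIns x r r′ (just y) → RowIns x₂ r₂ r′ (just y) →
                   AllPairs _≤_ r → AllPairs _≤_ r₂ → x ≡ x₂ × r ≡ r₂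
rowIns-injective (bump _) (bump _) _ _ = refl , refl
rowIns-injective (bump _) (skip _ rj) (ys ∷ _) _ =
  contradiction (All.lookup ys (rowIns-∈ rj)) (<⇒≱ (rowIns-bumped rj))
rowIns-injective (skip _ ri) (bump _) _ (ys ∷ _) =
  contradiction (All.lookup ys (rowIns-∈ ri)) (<⇒≱ (rowIns-bumped ri))
rowIns-injective (skip _ ri) (skip _ rj) (_ ∷ s) (_ ∷ s₂) with rowIns-injective ri rj s s₂
... | refl , refl = refl , refl

-- Once the row `k` is known, the bumping path can be retraced from its lower end. `SSYT` excludes
-- empty rows, for which `new` and `stop` could produce the same tableau.
ins-injective : ∀ {x x₂ T T₂ U k} → Ins x T U k → Ins x₂ T₂ U k → SSYT T → SSYT T₂ →
                x ≡ x₂ × T ≡ T₂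
ins-injective new new _ _ = refl , refl
ins-injective new (stop end) _ (cons () _ _ _)
ins-injective new (stop (skip _ ())) _ _
ins-injective (stop end) new (cons () _ _ _) _
ins-injective (stop (skip _ ())) new _ _
ins-injective (stop {row = row} ri) (stop {row = row₂} rj) _ _
  with ∷ʳ-injective row row₂ (trans (sym (rowIns-end ri)) (rowIns-end rj))
... | refl , refl = refl , refl
ins-injective (bump ri i) (bump rj j) (cons _ s _ t) (cons _ s₂ _ t₂) with ins-injective i j t t₂
... | refl , refl with rowIns-injective ri rj s s₂
... | refl , refl = refl , refl

-- Since `i` exceeds every entry of `T` and of `T₂`, its place in `U` shows which row was extended.
add-injective : ∀ {k k₂ i T T₂ U} → Add k i T U → Add k₂ i T₂ U → SSYT T → SSYT T₂ →
                All (_< i) (concat T) → All (_< i) (concat T₂) → k ≡ k₂ × T ≡ T₂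
add-injective {U = U} a a₂ s s₂ <i <i₂ = go a a₂ refl s s₂ <i <i₂
  where
  -- The two results stay separate with an equation between them, because unification cannot solve
  -- `row ∷ʳ i` against `row₂ ∷ʳ i`.
  go : ∀ {k k₂ i T T₂ U U₂} → Add k i T U → Add k₂ i T₂ U₂ → U ≡ U₂ → SSYT T → SSYT T₂ →
       All (_< i) (concat T) → All (_< i) (concat T₂) → k ≡ k₂ × T ≡ T₂
  go new new _ _ _ _ _ = refl , refl
  go new (here {row = r}) eq _ (cons ne _ _ _) _ _ with ∷ʳ-injectiveˡ [] r (∷-injectiveˡ eq)
  go new (here {row = r}) eq _ (cons () _ _ _) _ _ | refl
  go new (there new) ()
  go new (there here) ()
  go new (there (there _)) ()
  go (here {row = r}) new eq (cons ne _ _ _) _ _ _ with ∷ʳ-injectiveˡ r [] (∷-injectiveˡ eq)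
  go (here {row = r}) new eq (cons () _ _ _) _ _ _ | refl
  go (there new) new ()
  go (there here) new ()
  go (there (there _)) new ()
  go (here {row = r}) (here {row = r₂}) eq _ _ _ _
    with ∷ʳ-injectiveˡ r r₂ (∷-injectiveˡ eq) | ∷-injectiveʳ eq
  ... | refl | refl = refl , refl
  go (here {row = r}) (there {row = r₂} _) eq _ _ _ <i =
    contradiction (All.lookup (All.++⁻ˡ r₂ <i) (subst (_ ∈_) (∷-injectiveˡ eq) (∈.∈-++⁺ʳ r (here refl)))) (<-irrefl refl)
  go (there {row = r} _) (here {row = r₂}) eq _ _ <i _ =
    contradiction (All.lookup (All.++⁻ˡ r <i) (subst (_ ∈_) (sym (∷-injectiveˡ eq)) (∈.∈-++⁺ʳ r₂ (here refl)))) (<-irrefl refl)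
  go (there {row = r} a) (there {row = r₂} a₂) eq (cons _ _ _ t) (cons _ _ _ t₂) <i <i₂
    with go a a₂ (∷-injectiveʳ eq) t t₂ (All.++⁻ʳ r <i) (All.++⁻ʳ r₂ <i₂)
  ... | refl , refl = refl , cong (_∷ _) (∷-injectiveˡ eq)

run-injective : ∀ {h h₂ P Q} → Run h P Q → Run h₂ P Q → length h ≡ length h₂ → h ≡ h₂
run-injective [] [] _ = refl
run-injective (step {h = h} {Q = Q} r i a) (step {h = h₂} {Q = Q₂} {Q′ = U} {k = k₂} r₂ i₂ a₂) eq
  with add-injective a (subst (λ n → Add k₂ n Q₂ U) (cong suc (sym (suc-injective eq))) a₂)
         (run-SSYTʳ r) (run-SSYTʳ r₂) (run-<ʳ r) (subst (λ n → All (_< suc n) (concat Q₂)) (sym (suc-injective eq)) (run-<ʳ r₂))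
... | refl , refl with ins-injective i i₂ (run-SSYTˡ r) (run-SSYTˡ r₂)
... | refl , refl = cong (_ ∷_) (run-injective r r₂ (suc-injective eq))

-- Permutations and standard tableaux

unique-resp-↭ : ∀ {xs ys : List ℕ} → xs ↭ ys → Unique xs → Unique ys
unique-resp-↭ p = ↭ₛ.Unique-resp-↭ (setoid ℕ) (↭⇒↭ₛ p)

allPairs-lookup : ∀ {a r} {A : Set a} {R : A → A → Set r} {xs} → AllPairs R xs →
                  ∀ {i j} → i Fin.< j → R (lookup xs i) (lookup xs j)
allPairs-lookup (r ∷ _)  {Fin.zero}  {Fin.suc j} _         = All.lookup r (∈.∈-lookup j)
allPairs-lookup (_ ∷ rs) {Fin.suc i} {Fin.suc j} (s≤s i<j) = allPairs-lookup rs i<j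

lookup-injective : ∀ {a} {A : Set a} {xs : List A} → Unique xs → ∀ {i j} → lookup xs i ≡ lookup xs j → i ≡ j
lookup-injective u {i} {j} eq with Fin.<-cmp i j
... | tri< i<j _ _ = contradiction eq (allPairs-lookup u i<j)
... | tri≈ _ i≡j _ = i≡j
... | tri> _ _ j<i = contradiction (sym eq) (allPairs-lookup u j<i)

allPairs-++ˡ : ∀ {r} {R : ℕ → ℕ → Set r} xs {ys} → AllPairs R (xs ++ ys) → AllPairs R xs
allPairs-++ˡ []       _        = []
allPairs-++ˡ (x ∷ xs) (r ∷ rs) = All.++⁻ˡ xs r ∷ allPairs-++ˡ xs rs

allPairs-++ʳ : ∀ {r} {R : ℕ → ℕ → Set r} xs {ys} → AllPairs R (xs ++ ys) → AllPairs R ys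
allPairs-++ʳ []       rs       = rs
allPairs-++ʳ (x ∷ xs) (_ ∷ rs) = allPairs-++ʳ xs rs

strict-rows : ∀ {T} → SSYT T → Unique (concat T) → All (Linked _<_) T
strict-rows [] _ = []
strict-rows (cons {row} _ s _ t) u =
  Linked.AllPairs⇒Linked (AllPairs.zipWith (uncurry ≤∧≢⇒<) (s , allPairs-++ˡ row u)) ∷
  strict-rows t (allPairs-++ʳ row u)

SSYT-nonempty : ∀ {T} → SSYT T → All (λ row → 1 ≤ length row) T
SSYT-nonempty []              = []
SSYT-nonempty (cons ne _ _ t) = ne ∷ SSYT-nonempty t

SSYT-columns : ∀ {T} → SSYT T → Linked (λ upper lower → Prefix _>_ lower upper) T
SSYT-columns []                       = []
SSYT-columns (cons _ _ [] _)          = [-]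
SSYT-columns (cons _ _ (below p) t)   = p ∷ SSYT-columns t

SSYT⇒standard : ∀ {m T} → SSYT T → concat T ↭ range m → IsStandard m T
SSYT⇒standard {m} t e = record
  { nonEmptyRows = SSYT-nonempty t
  ; rows         = strict-rows t (unique-resp-↭ (↭-sym e) (range-unique m))
  ; columns      = SSYT-columns t
  ; entries      = e
  }

standard⇒SSYT : ∀ {m T} → IsStandard m T → SSYT T
standard⇒SSYT std = go nonEmptyRows rows columns
  where
  open IsStandard std
  weak : ∀ {row} → Linked _<_ row → AllPairs _≤_ row
  weak l = AllPairs.map <⇒≤ (Linked.Linked⇒AllPairs <-trans l)
  go : ∀ {T} → All (λ row → 1 ≤ length row) T → All (Linked _<_) T →
       Linked (λ upper lower → Prefix _>_ lower upper) T → SSYT T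
  go []        []       _       = []
  go (ne ∷ _)  (l ∷ _)  [-]     = cons ne (weak l) [] []
  go (ne ∷ ns) (l ∷ ls) (p ∷ c) = cons ne (weak l) (below p) (go ns ls c)

entry : ∀ {m} → Permutation′ m → Fin m → ℕ
entry π x = suc (toℕ (π ⟨$⟩ʳ x))

entry-injective : ∀ {m} (π : Permutation′ m) {x y} → entry π x ≡ entry π y → x ≡ y
entry-injective π {x} {y} eq = begin
  x                          ≡⟨ Perm.inverseˡ π ⟨
  π ⟨$⟩ˡ (π ⟨$⟩ʳ x)          ≡⟨ cong (π ⟨$⟩ˡ_) (Fin.toℕ-injective (suc-injective eq)) ⟩
  π ⟨$⟩ˡ (π ⟨$⟩ʳ y)          ≡⟨ Perm.inverseˡ π ⟩
  y                          ∎
  where open ≡-Reasoning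

∈-range⁺ : ∀ {m} (x : Fin m) → suc (toℕ x) ∈ range m
∈-range⁺ x = ∈.∈-map⁺ suc (∈.∈-upTo⁺ (Fin.toℕ<n x))

∈-range⁻ : ∀ {m k} → k ∈ range m → ∃[ x ] suc (toℕ {m} x) ≡ k
∈-range⁻ k∈ with ∈.∈-map⁻ suc k∈
... | j , j∈ , refl = fromℕ< (∈.∈-upTo⁻ j∈) , cong suc (Fin.toℕ-fromℕ< _)

word-unique : ∀ {m} (π : Permutation′ m) → Unique (word π)
word-unique π = Unique.tabulate⁺ (entry-injective π)

word-↭ : ∀ {m} (π : Permutation′ m) → word π ↭ range m
word-↭ {m} π = ∼bag⇒↭ (unique∧set⇒bag (word-unique π) (range-unique m) (mk⇔ to from))
  where
  to : ∀ {k} → k ∈ word π → k ∈ range m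
  to k∈ with ∈.∈-tabulate⁻ k∈
  ... | x , refl = ∈-range⁺ (π ⟨$⟩ʳ x)
  from : ∀ {k} → k ∈ range m → k ∈ word π
  from k∈ with ∈-range⁻ k∈
  ... | x , refl = subst (λ y → suc (toℕ y) ∈ word π) (Perm.inverseʳ π) (∈.∈-tabulate⁺ (π ⟨$⟩ˡ x))

word-surjective : ∀ {m} w → w ↭ range m → Σ[ π ∈ Permutation′ m ] word π ≡ w
word-surjective {m} w w↭ with trans (↭.↭-length w↭) (trans (length-map suc (upTo m)) (length-applyUpTo id m))
... | refl = Perm.permutation f g fg gf , trans (tabulate-cong f-lookup) (tabulate-lookup w)
  where
  lookup∈ : ∀ i → ∃[ x ] suc (toℕ {length w} x) ≡ lookup w i
  lookup∈ i = ∈-range⁻ (↭.∈-resp-↭ w↭ (∈.∈-lookup i))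
  f : Fin (length w) → Fin (length w)
  f i = proj₁ (lookup∈ i)
  f-lookup : ∀ i → suc (toℕ (f i)) ≡ lookup w i
  f-lookup i = proj₂ (lookup∈ i)
  g∈ : (y : Fin (length w)) → suc (toℕ y) ∈ w
  g∈ y = ↭.∈-resp-↭ (↭-sym w↭) (∈-range⁺ y)
  g : Fin (length w) → Fin (length w)
  g y = index (g∈ y)
  fg : ∀ y → f (g y) ≡ y
  fg y = Fin.toℕ-injective (suc-injective (trans (f-lookup (g y)) (sym (Any.lookup-index (g∈ y)))))
  gf : ∀ i → g (f i) ≡ i
  gf i = lookup-injective (unique-resp-↭ (↭-sym w↭) (range-unique (length w)))
           (trans (sym (Any.lookup-index (g∈ (f i)))) (f-lookup i))

run-RSK : ∀ {m} (π : Permutation′ m) → Run (reverse (word π)) (proj₁ (RSK π)) (proj₂ (RSK π))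
run-RSK π = run-insertWord (word π) []

length-history : ∀ {m} (π : Permutation′ m) → length (reverse (word π)) ≡ m
length-history π = trans (length-reverse (word π)) (length-tabulate (entry π))

tabulate-injective : ∀ {m} {f g : Fin m → ℕ} → tabulate f ≡ tabulate g → f ≗ g
tabulate-injective {suc m} eq Fin.zero    = ∷-injectiveˡ eq
tabulate-injective {suc m} eq (Fin.suc i) = tabulate-injective (∷-injectiveʳ eq) i

RSK-injective : ∀ {m} (π ρ : Permutation′ m) → RSK π ≡ RSK ρ → π ⟨$⟩ʳ_ ≗ ρ ⟨$⟩ʳ_
RSK-injective π ρ eq x = Fin.toℕ-injective (suc-injective (tabulate-injective
  (reverse-injective (run-injective (run-RSK π)
    (subst (λ PQ → Run (reverse (word ρ)) (proj₁ PQ) (proj₂ PQ)) (sym eq) (run-RSK ρ))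
    (trans (length-history π) (sym (length-history ρ))))) x))

RSK-surjective : ∀ {m P Q} → IsStandard m P → IsStandard m Q → shape P ≡ shape Q →
                 Σ[ π ∈ Permutation′ m ] RSK π ≡ (P , Q)
RSK-surjective {m} stdP stdQ eq
  with run-surjective m (standard⇒SSYT stdP) (standard⇒SSYT stdQ) eq (IsStandard.entries stdQ)
... | h , _ , r
  with word-surjective (reverse h)
         (↭-trans (↭.↭-reverse h) (↭-trans (↭-sym (run-↭ˡ r)) (IsStandard.entries stdP)))
... | π , π≡ = π , run-deterministic (subst (λ w → Run w _ _) (trans (cong reverse π≡) (reverse-involutive h)) (run-RSK π)) r

RSK-standardˡ : ∀ {m} (π : Permutation′ m) → IsStandard m (proj₁ (RSK π))
RSK-standardˡ π = SSYT⇒standard (run-SSYTˡ (run-RSK π))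
  (↭-trans (run-↭ˡ (run-RSK π)) (↭-trans (↭.↭-reverse (word π)) (word-↭ π)))

RSK-standardʳ : ∀ {m} (π : Permutation′ m) → IsStandard m (proj₂ (RSK π))
RSK-standardʳ π = SSYT⇒standard (run-SSYTʳ (run-RSK π))
  (subst (λ k → concat (proj₂ (RSK π)) ↭ range k) (length-history π) (run-↭ʳ (run-RSK π)))

RSK-cong : ∀ {m} (π ρ : Permutation′ m) → π ⟨$⟩ʳ_ ≗ ρ ⟨$⟩ʳ_ → RSK π ≡ RSK ρ
RSK-cong π ρ eq = cong (λ w → insertWord 1 w ([] , [])) (tabulate-cong (λ x → cong (suc ∘ toℕ) (eq x)))

-- Descents

rowIns-descent-stop : ∀ {x x′ r r′ r″ b} → RowIns x r r′ b → x′ < x → ¬ RowIns x′ r′ r″ nothing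
rowIns-descent-stop end         x′<x (skip x≤x′ _) = <⇒≱ x′<x x≤x′
rowIns-descent-stop (bump _)    x′<x (skip x≤x′ _) = <⇒≱ x′<x x≤x′
rowIns-descent-stop (skip _ ri) x′<x (skip _ rj)   = rowIns-descent-stop ri x′<x rj

-- The row now contains `x`, and `x′` bumps the first entry larger than itself on its path, which is
-- met no later than `x`.
rowIns-descent-bump : ∀ {x x′ r r′ r″ b y′} → RowIns x r r′ b → x′ < x → RowIns x′ r′ r″ (just y′) → y′ ≤ x
rowIns-descent-bump end          x′<x (bump _)      = ≤-refl
rowIns-descent-bump end          x′<x (skip x≤x′ _) = contradiction x≤x′ (<⇒≱ x′<x)
rowIns-descent-bump (bump _)     x′<x (bump _)      = ≤-refl
rowIns-descent-bump (bump _)     x′<x (skip x≤x′ _) = contradiction x≤x′ (<⇒≱ x′<x)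
rowIns-descent-bump (skip z≤x _) x′<x (bump _)      = z≤x
rowIns-descent-bump (skip _ ri)  x′<x (skip _ rj)   = rowIns-descent-bump ri x′<x rj

rowIns-ascent-stop : ∀ {x x′ r r′ r″ y′} → RowIns x r r′ nothing → x ≤ x′ → ¬ RowIns x′ r′ r″ (just y′)
rowIns-ascent-stop end          x≤x′ (bump x′<x) = <⇒≱ x′<x x≤x′
rowIns-ascent-stop (skip z≤x _) x≤x′ (bump x′<z) = <⇒≱ x′<z (≤-trans z≤x x≤x′)
rowIns-ascent-stop (skip _ ri)  x≤x′ (skip _ rj) = rowIns-ascent-stop ri x≤x′ rj

rowIns-bumped-∈ : ∀ {x r r′ y} → RowIns x r r′ (just y) → y ∈ r
rowIns-bumped-∈ (bump _)    = here refl
rowIns-bumped-∈ (skip _ ri) = there (rowIns-bumped-∈ ri)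

rowIns-ascent-bump : ∀ {x x′ r r′ r″ y y′} → AllPairs _≤_ r → RowIns x r r′ (just y) → x ≤ x′ →
                     RowIns x′ r′ r″ (just y′) → y ≤ y′
rowIns-ascent-bump _        (bump _)     x≤x′ (bump x′<x) = contradiction x≤x′ (<⇒≱ x′<x)
rowIns-ascent-bump (ys ∷ _) (bump _)     x≤x′ (skip _ rj) = All.lookup ys (rowIns-bumped-∈ rj)
rowIns-ascent-bump _        (skip z≤x _) x≤x′ (bump x′<z) = contradiction (≤-trans z≤x x≤x′) (<⇒≱ x′<z)
rowIns-ascent-bump (_ ∷ s)  (skip _ ri)  x≤x′ (skip _ rj) = rowIns-ascent-bump s ri x≤x′ rj

-- The first letter bumps something larger than `x`, the second something at most `x`, so the
-- descent is handed down to the next row. In each row the second letter must bump, so its path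
-- cannot end before the other or level with it.
ins-descent : ∀ {x x′ T T′ T″ k k′} → Ins x T T′ k → Ins x′ T′ T″ k′ → x′ < x → k < k′
ins-descent new        (stop rj)   x′<x = contradiction rj (rowIns-descent-stop end x′<x)
ins-descent new        (bump _ _)  x′<x = s≤s z≤n
ins-descent (stop ri)  (stop rj)   x′<x = contradiction rj (rowIns-descent-stop ri x′<x)
ins-descent (stop _)   (bump _ _)  x′<x = s≤s z≤n
ins-descent (bump ri _) (stop rj)  x′<x = contradiction rj (rowIns-descent-stop ri x′<x)
ins-descent (bump ri i) (bump rj j) x′<x =
  s≤s (ins-descent i j (≤-<-trans (rowIns-descent-bump ri x′<x rj) (rowIns-bumped ri)))

-- Bumped letters remain in weak order, and where the first letter is appended to a row the second
-- cannot bump any more.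
ins-ascent : ∀ {x x′ T T′ T″ k k′} → SSYT T → Ins x T T′ k → Ins x′ T′ T″ k′ → x ≤ x′ → k′ ≤ k
ins-ascent _ new       (stop _)    x≤x′ = z≤n
ins-ascent _ new       (bump rj _) x≤x′ = contradiction rj (rowIns-ascent-stop end x≤x′)
ins-ascent _ (stop _)  (stop _)    x≤x′ = z≤n
ins-ascent _ (stop ri) (bump rj _) x≤x′ = contradiction rj (rowIns-ascent-stop ri x≤x′)
ins-ascent _ (bump _ _) (stop _)   x≤x′ = z≤n
ins-ascent (cons _ s _ t) (bump ri i) (bump rj j) x≤x′ =
  s≤s (ins-ascent t i j (rowIns-ascent-bump s ri x≤x′ rj))

-- Row numbers are natural numbers, so that they can be compared between tableaux with different
-- numbers of rows.
InRow : Tableau → ℕ → ℕ → Set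
InRow T x k = Σ[ p ∈ Any (x ∈_) T ] toℕ (index p) ≡ k

inRow-there : ∀ {row T x k} → InRow T x k → InRow (row ∷ T) x (suc k)
inRow-there (p , eq) = there p , cong suc eq

add-new : ∀ {k i T T′} → Add k i T T′ → InRow T′ i k
add-new new                = here (here refl) , refl
add-new (here {row = row}) = here (∈.∈-++⁺ʳ row (here refl)) , refl
add-new (there a)          = inRow-there (add-new a)

add-old : ∀ {k i T T′ x j} → Add k i T T′ → InRow T x j → InRow T′ x j
add-old here      (here x∈ , eq) = here (∈.∈-++⁺ˡ x∈) , eq
add-old here      (there p , eq) = there p , eq
add-old (there a) (here x∈ , eq) = here x∈ , eq
add-old (there a) (there p , refl) = inRow-there (add-old a (p , refl))

disjoint-++ : ∀ xs {ys : List ℕ} {x} → Unique (xs ++ ys) → x ∈ xs → x ∉ ys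
disjoint-++ (_ ∷ xs) (u ∷ _)  (here refl) x∈ys = All.lookup u (∈.∈-++⁺ʳ xs x∈ys) refl
disjoint-++ (_ ∷ xs) (_ ∷ us) (there x∈)  x∈ys = disjoint-++ xs us x∈ x∈ys

inRow-functional : ∀ {T x} → Unique (concat T) → (p q : Any (x ∈_) T) → toℕ (index p) ≡ toℕ (index q)
inRow-functional u (here _) (here _) = refl
inRow-functional {row ∷ T} u (here p) (there q) = contradiction (∈.∈-concat⁺ q) (disjoint-++ row u p)
inRow-functional {row ∷ T} u (there p) (here q) = contradiction (∈.∈-concat⁺ p) (disjoint-++ row u q)
inRow-functional {row ∷ T} u (there p) (there q) = cong suc (inRow-functional (allPairs-++ʳ row u) p q)

run-prefix : ∀ h₁ {h P Q} → Run (h₁ ++ h) P Q →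
             ∃₂ λ P₀ Q₀ → Run h P₀ Q₀ × (∀ {x k} → InRow Q₀ x k → InRow Q x k)
run-prefix []       r            = _ , _ , r , id
run-prefix (_ ∷ h₁) (step r _ a) = let P₀ , Q₀ , r₀ , old = run-prefix h₁ r in P₀ , Q₀ , r₀ , add-old a ∘ old

-- The history has its latest letter first: `x` is letter number `suc (length h)` of the word and
-- `x′` is the next one. Boxes recorded for them are never moved by the later letters `h₁`.
run-rows : ∀ h₁ {x x′ h P Q} → Run (h₁ ++ x′ ∷ x ∷ h) P Q →
           ∃₂ λ k k′ → InRow Q (suc (length h)) k × InRow Q (suc (suc (length h))) k′ ×
                       (x′ < x → k < k′) × (x ≤ x′ → k′ ≤ k)
run-rows h₁ r with run-prefix h₁ r
... | _ , _ , step (step r₀ i a) i′ a′ , old =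
  _ , _ , old (add-old a′ (add-new a)) , old (add-new a′) , ins-descent i i′ , ins-ascent (run-SSYTˡ r₀) i i′

tabulate-split : ∀ {m} (f : Fin m → ℕ) p q → toℕ q ≡ suc (toℕ p) →
                 ∃₂ λ xs ys → tabulate f ≡ xs ++ f p ∷ f q ∷ ys × length xs ≡ toℕ p
tabulate-split f Fin.zero (Fin.suc Fin.zero) eq = [] , _ , refl , refl
tabulate-split f (Fin.suc p) (Fin.suc q) eq =
  let xs , ys , e , l = tabulate-split (f ∘ Fin.suc) p q (suc-injective eq)
  in f Fin.zero ∷ xs , ys , cong (f Fin.zero ∷_) e , cong suc l

history-split : ∀ {m} (f : Fin m → ℕ) p q → toℕ q ≡ suc (toℕ p) →
                ∃₂ λ h₁ h → reverse (tabulate f) ≡ h₁ ++ f q ∷ f p ∷ h × length h ≡ toℕ p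
history-split f p q eq with tabulate-split f p q eq
... | xs , ys , e , l = reverse ys , reverse xs , trans (cong reverse e) (reverse-split xs ys) , trans (length-reverse xs) l
  where
  reverse-split : ∀ xs ys → reverse (xs ++ f p ∷ f q ∷ ys) ≡ reverse ys ++ f q ∷ f p ∷ reverse xs
  reverse-split xs ys = begin
    reverse (xs ++ f p ∷ f q ∷ ys)                     ≡⟨ reverse-++ xs _ ⟩
    reverse (f p ∷ f q ∷ ys) ++ reverse xs             ≡⟨ cong (_++ reverse xs) (reverse-++ (f p ∷ f q ∷ []) ys) ⟩
    (reverse ys ++ f q ∷ f p ∷ []) ++ reverse xs       ≡⟨ ++-assoc (reverse ys) _ _ ⟩
    reverse ys ++ f q ∷ f p ∷ reverse xs               ∎
    where open ≡-Reasoning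

module _ {m} (π : Permutation′ m) {x x′ : Fin m} (succ : toℕ x′ ≡ suc (toℕ x)) where

  private
    Q = proj₂ (RSK π)

    rows : ∃₂ λ k k′ → InRow Q (suc (toℕ x)) k × InRow Q (suc (toℕ x′)) k′ ×
                       (entry π x′ < entry π x → k < k′) × (entry π x ≤ entry π x′ → k′ ≤ k)
    rows with history-split (entry π) x x′ succ
    ... | h₁ , h , eq , l with run-rows h₁ (subst (λ h → Run h (proj₁ (RSK π)) Q) eq (run-RSK π))
    ... | rows rewrite l | succ = rows

  recording-descent⁺ : π ⟨$⟩ʳ x′ Fin.< π ⟨$⟩ʳ x → RowStrictlyAbove Q (suc (toℕ x)) (suc (toℕ x′))
  recording-descent⁺ desc with rows
  ... | k , k′ , (p , refl) , (q , refl) , down , _ = p , q , down (s≤s desc)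

  recording-descent⁻ : RowStrictlyAbove Q (suc (toℕ x)) (suc (toℕ x′)) → π ⟨$⟩ʳ x′ Fin.< π ⟨$⟩ʳ x
  recording-descent⁻ (p , q , p<q) with rows
  ... | k , k′ , (p₀ , refl) , (q₀ , refl) , _ , up = ≰⇒> λ le → <⇒≱ p<q
    (subst₂ _≤_ (inRow-functional u q₀ q) (inRow-functional u p₀ p) (up (s≤s le)))
    where
    u : Unique (concat Q)
    u = unique-resp-↭ (↭-sym (IsStandard.entries (RSK-standardʳ π))) (range-unique m)

-- Reading words and descents of the insertion tableau

reading : Tableau → List ℕ
reading []        = []
reading (row ∷ T) = reading T ++ row

-- Row insertion performs Knuth moves on the reading word: the letters it
-- exchanges have another letter between them in value, so two letters of
-- consecutive values never change their relative order.
module _ {p} {P : ℕ → Set p} (P? : ∀ x → Dec (P x)) (close : ∀ {x y} → P x → P y → y ≤ suc x) where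

  filter-∷-cong : ∀ x {l l′} → filter P? l ≡ filter P? l′ → filter P? (x ∷ l) ≡ filter P? (x ∷ l′)
  filter-∷-cong x eq with P? x
  ... | yes _ = cong (x ∷_) eq
  ... | no  _ = eq

  filter-exchange : ∀ {x y} l → suc x < y → filter P? (x ∷ y ∷ l) ≡ filter P? (y ∷ x ∷ l)
  filter-exchange {x} {y} l x≪y with P? x in eqx | P? y in eqy
  ... | yes px | yes py = contradiction (close px py) (<⇒≱ x≪y)
  ... | yes px | no  _  rewrite eqx | eqy = refl
  ... | no  _  | yes _  rewrite eqx | eqy = refl
  ... | no  _  | no  _  rewrite eqx | eqy = refl

  filter-exchange-all : ∀ {x} ys → All (suc x <_) ys → filter P? (ys ++ [ x ]) ≡ filter P? (x ∷ ys)
  filter-exchange-all []       _         = refl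
  filter-exchange-all (y ∷ ys) (q ∷ qs) =
    trans (filter-∷-cong y (filter-exchange-all ys qs)) (sym (filter-exchange ys q))

  -- First `x` moves left past the letters beyond `y`, where `y` lies between in value; then `y`
  -- moves to the front past letters smaller than `x`, where `x` lies between. Distinct letters make
  -- these gaps strict.
  rowIns-filter : ∀ {x r r′ y} → RowIns x r r′ (just y) → AllPairs _<_ r → All (x ≢_) r →
                  filter P? (r ++ [ x ]) ≡ filter P? (y ∷ r′)
  rowIns-filter (bump {y = y} {ys} x<y) (ys> ∷ _) _ =
    filter-∷-cong y (filter-exchange-all ys (All.map (≤-<-trans x<y) ys>))
  rowIns-filter (skip {y = z} {ys′ = zs′} z≤x ri) (_ ∷ s) (x≢z ∷ x≢) =
    trans (filter-∷-cong z (rowIns-filter ri s x≢))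
          (filter-exchange zs′ (≤-<-trans (≤∧≢⇒< z≤x (x≢z ∘ sym)) (rowIns-bumped ri)))

  ins-filter : ∀ {x T T′ k} → Ins x T T′ k → SSYT T → Unique (x ∷ concat T) →
               filter P? (reading T′) ≡ filter P? (reading T ++ [ x ])
  ins-filter new _ _ = refl
  ins-filter {x} (stop {row = row} {T = T} ri) _ _ rewrite rowIns-end ri =
    cong (filter P?) (sym (++-assoc (reading T) row [ x ]))
  ins-filter {x} (bump {y = y} {row} {row′} {T} {T′} ri i) (cons _ s _ t) u@(x∉ ∷ ur) = begin
    filter P? (reading T′ ++ row′)                       ≡⟨ filter-++ P? (reading T′) row′ ⟩
    filter P? (reading T′) ++ filter P? row′             ≡⟨ cong (_++ filter P? row′) (ins-filter i t uy) ⟩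
    filter P? (reading T ++ [ y ]) ++ filter P? row′     ≡⟨ filter-++ P? (reading T ++ [ y ]) row′ ⟨
    filter P? ((reading T ++ [ y ]) ++ row′)             ≡⟨ cong (filter P?) (++-assoc (reading T) [ y ] row′) ⟩
    filter P? (reading T ++ y ∷ row′)                    ≡⟨ filter-++ P? (reading T) (y ∷ row′) ⟩
    filter P? (reading T) ++ filter P? (y ∷ row′)        ≡⟨ cong (filter P? (reading T) ++_) (rowIns-filter ri strict (All.++⁻ˡ row x∉)) ⟨
    filter P? (reading T) ++ filter P? (row ++ [ x ])    ≡⟨ filter-++ P? (reading T) (row ++ [ x ]) ⟨
    filter P? (reading T ++ row ++ [ x ])                ≡⟨ cong (filter P?) (++-assoc (reading T) row [ x ]) ⟨
    filter P? ((reading T ++ row) ++ [ x ])              ∎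
    where
    open ≡-Reasoning
    strict : AllPairs _<_ row
    strict = AllPairs.zipWith (uncurry ≤∧≢⇒<) (s , allPairs-++ˡ row ur)
    uy : Unique (y ∷ concat T)
    uy with unique-resp-↭ (↭.++⁺ʳ (concat T) (rowIns-↭ ri)) u
    ... | y∉ ∷ u′ = All.++⁻ʳ row′ y∉ ∷ allPairs-++ʳ row′ u′

  run-filter : ∀ {h P Q} → Run h P Q → Unique h → filter P? (reading P) ≡ filter P? (reverse h)
  run-filter [] _ = refl
  run-filter {x ∷ h} (step {P = T} {P′ = T′} r i _) (x∉ ∷ u) = begin
    filter P? (reading T′)                         ≡⟨ ins-filter i (run-SSYTˡ r) (unique-resp-↭ (prep x (↭-sym (run-↭ˡ r))) (x∉ ∷ u)) ⟩
    filter P? (reading T ++ [ x ])                 ≡⟨ filter-++ P? (reading T) [ x ] ⟩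
    filter P? (reading T) ++ filter P? [ x ]       ≡⟨ cong (_++ filter P? [ x ]) (run-filter r u) ⟩
    filter P? (reverse h) ++ filter P? [ x ]       ≡⟨ filter-++ P? (reverse h) [ x ] ⟨
    filter P? (reverse h ++ [ x ])                 ≡⟨ cong (filter P?) (unfold-reverse x h) ⟨
    filter P? (reverse (x ∷ h))                    ∎
    where open ≡-Reasoning

  filter-⊆⁺ : ∀ {v w} → All P v → v ⊆ w → v ⊆ filter P? w
  filter-⊆⁺ {v} ps v⊆w = subst (_⊆ _) (filter-all P? ps) (Sublist.filter⁺ P? P? (subst P) v⊆w)

⊆-++⁻ : ∀ {x y : ℕ} xs {ys} → x ∷ [ y ] ⊆ xs ++ ys →
        x ∷ [ y ] ⊆ xs ⊎ (x ∈ xs × y ∈ ys) ⊎ x ∷ [ y ] ⊆ ys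
⊆-++⁻ [] s = inj₂ (inj₂ s)
⊆-++⁻ (z ∷ xs) (.z Sublist.∷ʳ s) with ⊆-++⁻ xs s
... | inj₁ s′               = inj₁ (z Sublist.∷ʳ s′)
... | inj₂ (inj₁ (x∈ , y∈)) = inj₂ (inj₁ (there x∈ , y∈))
... | inj₂ (inj₂ s′)        = inj₂ (inj₂ s′)
⊆-++⁻ (z ∷ xs) (refl ∷ s) with ∈.∈-++⁻ xs (to∈ s)
... | inj₁ y∈ = inj₁ (refl ∷ from∈ y∈)
... | inj₂ y∈ = inj₂ (inj₁ (here refl , y∈))

allPairs-⊆ : ∀ {r} {R : ℕ → ℕ → Set r} {x y xs} → AllPairs R xs → x ∷ [ y ] ⊆ xs → R x y
allPairs-⊆ (_ ∷ rs) (_ Sublist.∷ʳ s) = allPairs-⊆ rs s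
allPairs-⊆ (r ∷ _)  (refl ∷ s)       = All.lookup r (to∈ s)

∈-reading⁺ : ∀ {x T} → Any (x ∈_) T → x ∈ reading T
∈-reading⁺ {T = row ∷ T} (here p)  = ∈.∈-++⁺ʳ (reading T) p
∈-reading⁺ {T = row ∷ T} (there p) = ∈.∈-++⁺ˡ (∈-reading⁺ p)

∈-reading⁻ : ∀ {x} T → x ∈ reading T → Any (x ∈_) T
∈-reading⁻ (row ∷ T) x∈ with ∈.∈-++⁻ (reading T) x∈
... | inj₁ p = there (∈-reading⁻ T p)
... | inj₂ p = here p

above⇒⊆ : ∀ {x y T} → RowStrictlyAbove T x y → y ∷ [ x ] ⊆ reading T
above⇒⊆ (here p  , there q , _)         = Sublist.++⁺ (from∈ (∈-reading⁺ q)) (from∈ p)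
above⇒⊆ (there p , there q , s≤s p<q)   = Sublist.++⁺ʳ _ (above⇒⊆ (p , q , p<q))

-- The reading word lists lower rows first and each row in weakly increasing order, so a larger
-- letter that comes before `x` belongs to a lower row.
⊆⇒above : ∀ {x y T} → SSYT T → x < y → y ∷ [ x ] ⊆ reading T → RowStrictlyAbove T x y
⊆⇒above {T = row ∷ T} (cons _ s _ t) x<y sub with ⊆-++⁻ (reading T) sub
... | inj₁ sub′ = let p , q , p<q = ⊆⇒above t x<y sub′ in there p , there q , s≤s p<q
... | inj₂ (inj₁ (y∈ , x∈)) = here x∈ , there (∈-reading⁻ T y∈) , s≤s z≤n
... | inj₂ (inj₂ sub′) = contradiction (allPairs-⊆ s sub′) (<⇒≱ x<y)

⊆-tabulate⁺ : ∀ {m} (f : Fin m → ℕ) {i j} → i Fin.< j → f i ∷ [ f j ] ⊆ tabulate f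
⊆-tabulate⁺ f {Fin.zero}  {Fin.suc j} _         = refl ∷ from∈ (∈.∈-tabulate⁺ j)
⊆-tabulate⁺ f {Fin.suc i} {Fin.suc j} (s≤s i<j) = _ Sublist.∷ʳ ⊆-tabulate⁺ (f ∘ Fin.suc) i<j

module _ {m} (π : Permutation′ m) {x x′ : Fin m} (succ : toℕ x′ ≡ suc (toℕ x)) where

  private
    P = proj₁ (RSK π)
    k = suc (toℕ x)
    k′ = suc (toℕ x′)

    k<k′ : k < k′
    k<k′ = s≤s (≤-reflexive (sym succ))

    Adjacent : ℕ → Set
    Adjacent z = z ≡ k ⊎ z ≡ k′

    adjacent? : ∀ z → Dec (Adjacent z)
    adjacent? z = (z ≟ k) ⊎-dec (z ≟ k′)

    close : ∀ {z z′} → Adjacent z → Adjacent z′ → z′ ≤ suc z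
    close (inj₁ refl) (inj₁ refl) = n≤1+n k
    close (inj₁ refl) (inj₂ refl) = s≤s (≤-reflexive succ)
    close (inj₂ refl) (inj₁ refl) = m≤n⇒m≤1+n (<⇒≤ k<k′)
    close (inj₂ refl) (inj₂ refl) = n≤1+n k′

    filters : filter adjacent? (reading P) ≡ filter adjacent? (word π)
    filters = trans
      (run-filter adjacent? close (run-RSK π) (unique-resp-↭ (↭-sym (↭.↭-reverse (word π))) (word-unique π)))
      (cong (filter adjacent?) (reverse-involutive (word π)))

    both : All Adjacent (k′ ∷ [ k ])
    both = inj₂ refl ∷ inj₁ refl ∷ []

    transport : ∀ {v w} → filter adjacent? v ≡ filter adjacent? w → k′ ∷ [ k ] ⊆ v → k′ ∷ [ k ] ⊆ w
    transport {v} {w} eq s = ⊆-trans (subst (k′ ∷ [ k ] ⊆_) eq (filter-⊆⁺ adjacent? close both s)) (Sublist.filter-⊆ adjacent? w)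

    entry-inverse : ∀ y → entry π (π ⟨$⟩ˡ y) ≡ suc (toℕ y)
    entry-inverse y = cong (suc ∘ toℕ) (Perm.inverseʳ π)

  insertion-descent⁺ : π ⟨$⟩ˡ x′ Fin.< π ⟨$⟩ˡ x → RowStrictlyAbove P k k′
  insertion-descent⁺ desc = ⊆⇒above (run-SSYTˡ (run-RSK π)) k<k′ (transport (sym filters)
    (subst₂ (λ a b → a ∷ [ b ] ⊆ word π) (entry-inverse x′) (entry-inverse x) (⊆-tabulate⁺ (entry π) desc)))

  insertion-descent⁻ : RowStrictlyAbove P k k′ → π ⟨$⟩ˡ x′ Fin.< π ⟨$⟩ˡ x
  insertion-descent⁻ above with allPairs-⊆ ordered (transport filters (above⇒⊆ above))
    where
    ordered : AllPairs (λ a b → ∃₂ λ i j → i Fin.< j × entry π i ≡ a × entry π j ≡ b) (word π)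
    ordered = AllPairs.tabulate⁺-< λ {i} {j} i<j → i , j , i<j , refl , refl
  ... | i , j , i<j , ei , ej =
    subst₂ Fin._<_ (entry-injective π (trans ei (sym (entry-inverse x′))))
                   (entry-injective π (trans ej (sym (entry-inverse x)))) i<j

-- Increasing subsequences and the first row

firstRow : Tableau → List ℕ
firstRow []        = []
firstRow (row ∷ _) = row

firstRow-ins : ∀ {x P P′ k} → Ins x P P′ k → ∃[ b ] RowIns x (firstRow P) (firstRow P′) b
firstRow-ins new         = _ , end
firstRow-ins (stop ri)   = _ , ri
firstRow-ins (bump ri _) = _ , ri

Chain : List ℕ → ℕ → ℕ → Set
Chain h x c = ∃[ s ] (s ⊆ h × Linked _≥_ (x ∷ s) × length s ≡ c)

-- Schensted's invariant for the part of the first row starting at column `c`, counted from 0: the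
-- entry in column `j` ends a weakly increasing subsequence of `suc j` letters. Subsequences are
-- read from their latest letter, hence `_≥_`.
data Chains (h : List ℕ) : ℕ → List ℕ → Set where
  []  : ∀ {c} → Chains h c []
  _∷_ : ∀ {c y ys} → ∃[ s ] (y ∷ s ⊆ h × Linked _≥_ (y ∷ s) × length s ≡ c) →
        Chains h (suc c) ys → Chains h c (y ∷ ys)

chains-weaken : ∀ {h c R x} → Chains h c R → Chains (x ∷ h) c R
chains-weaken []                      = []
chains-weaken ((s , sub , l , e) ∷ cs) = (s , _ Sublist.∷ʳ sub , l , e) ∷ chains-weaken cs

-- The entry to the left of the place where `x` lands is at most `x`, so `x` prolongs its chain. The
-- argument `Chain h x c` carries that chain along the row.
chains-ins : ∀ {x R R′ b h c} → RowIns x R R′ b → Chain h x c → Chains h c R → Chains (x ∷ h) c R′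
chains-ins end      (s , sub , l , e) _        = (s , refl ∷ sub , l , e) ∷ []
chains-ins (bump _) (s , sub , l , e) (_ ∷ cs) = (s , refl ∷ sub , l , e) ∷ chains-weaken cs
chains-ins (skip y≤x ri) _ ((s , sub , l , e) ∷ cs) =
  (s , _ Sublist.∷ʳ sub , l , e) ∷ chains-ins ri (_ ∷ s , sub , y≤x ∷ l , cong suc e) cs

chains-last : ∀ {h c R} → (∃[ s ] (s ⊆ h × Linked _≥_ s × length s ≡ c)) → Chains h c R →
              ∃[ s ] (s ⊆ h × Linked _≥_ s × length s ≡ c + length R)
chains-last (s , sub , l , e) [] = s , sub , l , trans e (sym (+-identityʳ _))
chains-last {c = c} _ (_∷_ {ys = ys} (s , sub , l , e) cs) =
  let s′ , sub′ , l′ , e′ = chains-last (_ ∷ s , sub , l , cong suc e) cs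
  in s′ , sub′ , l′ , trans e′ (sym (+-suc c (length ys)))

run-chains : ∀ {h P Q} → Run h P Q → Chains h 0 (firstRow P)
run-chains []           = []
run-chains (step r i _) = chains-ins (proj₂ (firstRow-ins i)) ([] , Sublist.minimum _ , [-] , refl) (run-chains r)

-- Colouring letters by columns of the first row

module _ {p a} {P : Set p} {A : Set a} {x y : A} where

  if-yes : (P? : Dec P) → P → (if does P? then x else y) ≡ x
  if-yes (yes _) _ = refl
  if-yes (no ¬p) p = contradiction p ¬p

  if-no : (P? : Dec P) → ¬ P → (if does P? then x else y) ≡ y
  if-no (yes p) ¬p = contradiction p ¬p
  if-no (no _)  _  = refl

-- For a sorted row this is the column, counted from 0, in which `z` would be inserted. Written as a
-- count of the entries up to `z`, it is monotone by a termwise comparison.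
rank : ℕ → List ℕ → ℕ
rank z []       = 0
rank z (y ∷ ys) = (if does (y ≤? z) then 1 else 0) + rank z ys

indicator-mono : ∀ {p q} {P : Set p} {Q : Set q} (P? : Dec P) (Q? : Dec Q) → (P → Q) →
                 (if does P? then 1 else 0) ≤ (if does Q? then 1 else 0)
indicator-mono (no _)  _       _ = z≤n
indicator-mono (yes _) (yes _) _ = ≤-refl
indicator-mono (yes p) (no ¬q) f = contradiction (f p) ¬q

rank-monoˡ : ∀ {z z′} R → z ≤ z′ → rank z R ≤ rank z′ R
rank-monoˡ []           z≤z′ = z≤n
rank-monoˡ {z} {z′} (y ∷ R) z≤z′ =
  +-mono-≤ (indicator-mono (y ≤? z) (y ≤? z′) (λ y≤z → ≤-trans y≤z z≤z′)) (rank-monoˡ R z≤z′)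

rank-≤-length : ∀ z R → rank z R ≤ length R
rank-≤-length z []      = z≤n
-- An indicator is bounded by 1 by comparing it with a decision that is always positive.
rank-≤-length z (y ∷ R) = +-mono-≤ (indicator-mono (y ≤? z) (yes refl) (λ _ → refl {x = z})) (rank-≤-length z R)

-- Insertion appends a letter or puts a smaller one in place of a larger. As ranks never fall, an
-- earlier letter keeps its colour below its rank, hence below the colour of any larger letter
-- inserted later.
rank-ins : ∀ {x R R′ b} z → RowIns x R R′ b → rank z R ≤ rank z R′
rank-ins z end = z≤n
rank-ins {x} z (bump {y = y} {ys} x<y) =
  +-monoˡ-≤ (rank z ys) (indicator-mono (y ≤? z) (x ≤? z) (≤-trans (<⇒≤ x<y)))
rank-ins z (skip _ ri) = +-monoʳ-≤ _ (rank-ins z ri)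

rank-ins-self : ∀ {x R R′ b} → RowIns x R R′ b → rank x R < rank x R′
rank-ins-self {x} end rewrite if-yes {x = 1} {0} (x ≤? x) ≤-refl = s≤s z≤n
rank-ins-self {x} (bump {y = y} x<y)
  rewrite if-yes {x = 1} {0} (x ≤? x) ≤-refl | if-no {x = 1} {0} (y ≤? x) (<⇒≱ x<y) = ≤-refl
rank-ins-self {x} (skip {y = y} {ys} _ ri)
  rewrite sym (+-suc (if does (y ≤? x) then 1 else 0) (rank x ys)) =
  +-monoʳ-≤ (if does (y ≤? x) then 1 else 0) (rank-ins-self ri)

-- The colour of a letter is the column of the first row in which it is inserted.
run-colouring : ∀ {h P Q} → Run h P Q → Unique h →
  Σ[ colour ∈ (ℕ → ℕ) ] All (λ y → colour y < rank y (firstRow P)) h ×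
                        AllPairs (λ y y′ → y′ < y → colour y′ < colour y) h
run-colouring [] _ = id , [] , []
run-colouring {x ∷ h} (step {P = T} {P′ = T′} r i _) (x∉ ∷ u) with run-colouring r u
... | colour , bounds , increasing = colour′ , bound-x ∷ bounds-h , increasing-x ∷ increasing-h
  where
  ri = proj₂ (firstRow-ins i)
  colour′ : ℕ → ℕ
  colour′ y = if does (x ≟ y) then rank x (firstRow T) else colour y
  colour′-x : colour′ x ≡ rank x (firstRow T)
  colour′-x = if-yes (x ≟ x) refl
  colour′-h : ∀ {y} → x ≢ y → colour′ y ≡ colour y
  colour′-h {y} = if-no (x ≟ y)
  bound-x : colour′ x < rank x (firstRow T′)
  bound-x = subst (_< _) (sym colour′-x) (rank-ins-self ri)
  bounds-h : All (λ y → colour′ y < rank y (firstRow T′)) h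
  bounds-h = All.zipWith (λ {y} (x≢y , b) → subst (_< _) (sym (colour′-h x≢y)) (<-≤-trans b (rank-ins y ri))) (x∉ , bounds)
  increasing-x : All (λ y → y < x → colour′ y < colour′ x) h
  increasing-x = All.zipWith (λ {y} (x≢y , b) y<x → subst₂ _<_ (sym (colour′-h x≢y)) (sym colour′-x)
    (<-≤-trans b (rank-monoˡ (firstRow T) (<⇒≤ y<x)))) (x∉ , bounds)
  increasing-h : AllPairs (λ y y′ → y′ < y → colour′ y′ < colour′ y) h
  increasing-h = go x∉ increasing
    where
    go : ∀ {h} → All (x ≢_) h → AllPairs (λ y y′ → y′ < y → colour y′ < colour y) h →
         AllPairs (λ y y′ → y′ < y → colour′ y′ < colour′ y) h
    go [] [] = []
    go (x≢y ∷ x∉) (q ∷ qs) =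
      All.zipWith (λ (x≢y′ , f) lt → subst₂ _<_ (sym (colour′-h x≢y′)) (sym (colour′-h x≢y)) (f lt)) (x∉ , q) ∷ go x∉ qs

module _ {a r} {A : Set a} {R : A → A → Set r} where

  allPairs-reverse : ∀ {xs} → AllPairs R xs → AllPairs (flip R) (reverse xs)
  allPairs-reverse []                    = []
  allPairs-reverse {x ∷ xs} (rs ∷ rss) = subst (AllPairs (flip R)) (sym (unfold-reverse x xs))
    (AllPairs.++⁺ (allPairs-reverse rss) ([] ∷ [])
      (All.map (_∷ []) (↭.All-resp-↭ (↭-sym (↭.↭-reverse xs)) rs)))

  allPairs-resp-⊆ : ∀ {xs ys} → xs ⊆ ys → AllPairs R ys → AllPairs R xs
  allPairs-resp-⊆ []                  _          = []
  allPairs-resp-⊆ (_ Sublist.∷ʳ s)    (_ ∷ rs)  = allPairs-resp-⊆ s rs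
  allPairs-resp-⊆ (refl ∷ s)          (r ∷ rs)  = Sublist.All-resp-⊆ s r ∷ allPairs-resp-⊆ s rs

  allPairs-tabulate⁻ : ∀ {m} {f : Fin m → A} → AllPairs R (tabulate f) → ∀ {i j} → i Fin.< j → R (f i) (f j)
  allPairs-tabulate⁻ (r ∷ _)  {Fin.zero}  {Fin.suc j} _         = All.tabulate⁻ r j
  allPairs-tabulate⁻ (_ ∷ rs) {Fin.suc i} {Fin.suc j} (s≤s i<j) = allPairs-tabulate⁻ rs i<j

⊆-map⁻ : ∀ {A : Set} (f : A → ℕ) {s} xs → s ⊆ map f xs → ∃[ s′ ] (s ≡ map f s′ × s′ ⊆ xs)
⊆-map⁻ f []       []                = [] , refl , []
⊆-map⁻ f (x ∷ xs) (_ Sublist.∷ʳ sub) = let s′ , e , sub′ = ⊆-map⁻ f xs sub in s′ , e , x Sublist.∷ʳ sub′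
⊆-map⁻ f (x ∷ xs) (refl ∷ sub)      = let s′ , e , sub′ = ⊆-map⁻ f xs sub in x ∷ s′ , cong (f x ∷_) e , refl ∷ sub′

width : ∀ {m} → Permutation′ m → ℕ
width π = length (firstRow (proj₁ (RSK π)))

module _ {m} (π : Permutation′ m) where

  private
    history-unique : Unique (reverse (word π))
    history-unique = unique-resp-↭ (↭-sym (↭.↭-reverse (word π))) (word-unique π)

  Increasing : Fin m → Fin m → Set
  Increasing i j = i Fin.< j × π ⟨$⟩ʳ i Fin.< π ⟨$⟩ʳ j

  increasing-subsequence : ∃[ s ] (AllPairs (flip Increasing) s × length s ≡ width π)
  increasing-subsequence with chains-last ([] , Sublist.minimum _ , [] , refl) (run-chains (run-RSK π))
  ... | s , sub , l , e
    with ⊆-map⁻ (entry π) (reverse (allFin m)) (subst (s ⊆_) (trans (cong reverse (sym (map-tabulate id (entry π)))) (sym (reverse-map (entry π) (allFin m)))) sub)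
  ... | s′ , refl , sub′ = s′ , AllPairs.zipWith strict (later , larger) , trans (sym (length-map (entry π) s′)) e
    where
    later : AllPairs (flip Fin._<_) s′
    later = allPairs-resp-⊆ sub′ (allPairs-reverse (AllPairs.tabulate⁺-< id))
    larger : AllPairs (λ i j → entry π i ≥ entry π j) s′
    larger = AllPairs.map⁻ (Linked.Linked⇒AllPairs (flip ≤-trans) l)
    strict : ∀ {i j} → j Fin.< i × entry π i ≥ entry π j → Increasing j i
    strict (j<i , ge) = j<i , s≤s⁻¹ (≤∧≢⇒< ge λ eq → Fin.<⇒≢ j<i (entry-injective π eq))

  -- With `increasing-subsequence` this gives Schensted's theorem. A colouring turns maximality into
  -- the pigeonhole principle: the terms of an increasing sequence receive distinct colours below
  -- `width π`.
  colouring : Σ[ colour ∈ (Fin m → ℕ) ] (∀ i → colour i < width π) × (∀ {i j} → Increasing i j → colour i < colour j)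
  colouring with run-colouring (run-RSK π) history-unique
  ... | colour , bounds , increasing = colour ∘ entry π
    , (λ i → <-≤-trans (All.tabulate⁻ (↭.All-resp-↭ (↭.↭-reverse (word π)) bounds) i) (rank-≤-length (entry π i) (firstRow (proj₁ (RSK π)))))
    , (λ (i<j , πi<πj) → allPairs-tabulate⁻ (subst (AllPairs _) (reverse-involutive (word π)) (allPairs-reverse increasing)) i<j (s≤s πi<πj))

rows-≤ : ∀ {T d} → SSYT T → length (firstRow T) ≤ d → All (λ row → length row ≤ d) T
rows-≤ [] _ = []
rows-≤ (cons _ _ b t) le = le ∷ rows-≤ t (≤-trans (shorter b) le)
  where
  shorter : ∀ {row T} → Below row T → length (firstRow T) ≤ length row
  shorter []        = z≤n
  shorter (below p) = Prefix.length-mono p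

firstRow-≤ : ∀ {T d} → All (λ row → length row ≤ d) T → length (firstRow T) ≤ d
firstRow-≤ []       = z≤n
firstRow-≤ (le ∷ _) = le

-- The configuration associated with a regular multigraph

-- Unfolds to `laterAtᵁ` or `laterAtⱽ` when `g` gives the multiplicities at a fixed vertex of `U` or
-- of `V`, so that both sides share the lemmas on cells.
later : ∀ {n} → (Fin n → ℕ) → Fin n → ℕ
later {n} g v = ∑[ v′ < n ] (if does (v Fin.<? v′) then g v′ else 0)

later-cong : ∀ {n} {g g′ : Fin n → ℕ} → g ≗ g′ → later g ≗ later g′
later-cong eq v = sum-cong-≗ λ v′ → cong (λ k → if does (v Fin.<? v′) then k else 0) (eq v′)

-- The cells cut the positions from 0 up to `sum g` into consecutive intervals of lengths `g v`,
-- with the cell of the last vertex first.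
InCell : ∀ {n} → (Fin n → ℕ) → Fin n → ℕ → Set
InCell g v a = later g v ≤ a × a < later g v + g v

cell-exists : ∀ {n} (g : Fin n → ℕ) {a} → a < sum g → ∃[ v ] InCell g v a
cell-exists {suc n} g {a} a< with a <? sum (g ∘ Fin.suc)
-- The first term of `later g (Fin.suc v)` computes to 0, so the cell is definitionally that of the
-- tail. In the other case, the sum of the tail is where the cell of `Fin.zero` starts.
... | yes a<′ = let v , c = cell-exists (g ∘ Fin.suc) a<′ in Fin.suc v , c
... | no  a≮  = Fin.zero , ≮⇒≥ a≮ , subst (a <_) (+-comm (g Fin.zero) _) a<

cell-bound : ∀ {n} (g : Fin n → ℕ) v → later g v + g v ≤ sum g
cell-bound g Fin.zero    = ≤-reflexive (+-comm _ (g Fin.zero))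
cell-bound g (Fin.suc v) = ≤-trans (cell-bound (g ∘ Fin.suc) v) (m≤n+m _ (g Fin.zero))

later-antitone : ∀ {n} (g : Fin n → ℕ) {v v′} → v Fin.< v′ → later g v′ + g v′ ≤ later g v
later-antitone g {Fin.zero}  {Fin.suc v′} _          = cell-bound (g ∘ Fin.suc) v′
later-antitone g {Fin.suc v} {Fin.suc v′} (s≤s v<v′) = later-antitone (g ∘ Fin.suc) v<v′

cell-order : ∀ {n} (g : Fin n → ℕ) {v v′ a a′} → InCell g v a → InCell g v′ a′ → a ≤ a′ → v′ Fin.≤ v
cell-order g (lo , _) (_ , hi) a≤a′ =
  ≮⇒≥ λ v<v′ → <⇒≱ (<-≤-trans hi (later-antitone g v<v′)) (≤-trans lo a≤a′)

cell-unique : ∀ {n} (g : Fin n → ℕ) {v v′ a} → InCell g v a → InCell g v′ a → v ≡ v′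
cell-unique g c c′ = Fin.≤-antisym (cell-order g c′ c ≤-refl) (cell-order g c c′ ≤-refl)

-- In the copies of u the edge uv occupies an interval of length G (u , v), in the
-- copies of v another one, and the two are joined by the reversing bijection.
-- The relation is symmetric in u and v.
Joined : ∀ {n r} → Multigraph n → Copies n r → Copies n r → Set
Joined G (u , p) (v , q) = ∃₂ λ a b →
  toℕ p ≡ laterAtᵁ G (u , v) + a × toℕ q ≡ laterAtⱽ G (u , v) + b × suc (a + b) ≡ G (u , v)

transpose : ∀ {n} → Multigraph n → Multigraph n
transpose G (v , u) = G (u , v)

transpose-regular : ∀ {n r} {G : Multigraph n} → IsRegular r G → IsRegular r (transpose G)
transpose-regular reg = record { regularᵁ = regularⱽ ; regularⱽ = regularᵁ }
  where open IsRegular reg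

joined-sym : ∀ {n r} {G : Multigraph n} {x y : Copies n r} → Joined G x y → Joined (transpose G) y x
joined-sym (a , b , ep , eq , et) = b , a , eq , ep , trans (cong suc (+-comm b a)) et

joined-resp : ∀ {n r} {G G′ : Multigraph n} → G ≗ G′ → {x y : Copies n r} → Joined G x y → Joined G′ x y
joined-resp e {u , _} {v , _} (a , b , ep , eq , et) = a , b
  , trans ep (cong (_+ a) (later-cong (λ v′ → e (u , v′)) v))
  , trans eq (cong (_+ b) (later-cong (λ u′ → e (u′ , v)) u))
  , trans et (e (u , v))

joined-cell : ∀ {n r} {G : Multigraph n} {u v} {p q : Fin r} → Joined G (u , p) (v , q) →
              InCell (λ v → G (u , v)) v (toℕ p)
joined-cell {G = G} {u} {v} (a , b , ep , _ , et) rewrite ep =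
  m≤m+n _ a , +-monoʳ-< (laterAtᵁ G (u , v)) (≤-trans (s≤s (m≤m+n a b)) (≤-reflexive et))

joined-functional : ∀ {n r} {G : Multigraph n} {x y y′ : Copies n r} → Joined G x y → Joined G x y′ → y ≡ y′
joined-functional {G = G} {x = u , p} {v , q} {v′ , q′} j j′
  with cell-unique (λ v → G (u , v)) (joined-cell {G = G} j) (joined-cell {G = G} j′)
joined-functional {G = G} {x = u , p} {v , q} {.v , q′} (a , b , ep , eq , et) (a′ , b′ , ep′ , eq′ , et′) | refl
  with +-cancelˡ-≡ (laterAtᵁ G (u , v)) a a′ (trans (sym ep) ep′)
... | refl with +-cancelˡ-≡ (suc a) b b′ (trans et (sym et′))
... | refl = cong (v ,_) (Fin.toℕ-injective (trans eq (sym eq′)))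

module _ {n r} {G : Multigraph n} (reg : IsRegular r G) where
  open IsRegular reg

  boundᵁ : ∀ u v {a} → a < G (u , v) → laterAtᵁ G (u , v) + a < r
  boundᵁ u v a<t = <-≤-trans (+-monoʳ-< (laterAtᵁ G (u , v)) a<t)
    (≤-trans (cell-bound (λ v → G (u , v)) v) (≤-reflexive (regularᵁ u)))

  boundⱽ : ∀ u v {b} → b < G (u , v) → laterAtⱽ G (u , v) + b < r
  boundⱽ u v b<t = <-≤-trans (+-monoʳ-< (laterAtⱽ G (u , v)) b<t)
    (≤-trans (cell-bound (λ u → G (u , v)) u) (≤-reflexive (regularⱽ v)))

  join : ∀ u v {a b} → suc (a + b) ≡ G (u , v) → Σ[ p ∈ Fin r ] Σ[ q ∈ Fin r ]
         (toℕ p ≡ laterAtᵁ G (u , v) + a × toℕ q ≡ laterAtⱽ G (u , v) + b)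
  join u v {a} {b} et = fromℕ< p< , fromℕ< q< , Fin.toℕ-fromℕ< p< , Fin.toℕ-fromℕ< q<
    where
    p< = boundᵁ u v (≤-trans (s≤s (m≤m+n a b)) (≤-reflexive et))
    q< = boundⱽ u v (≤-trans (s≤s (m≤n+m b a)) (≤-reflexive et))

  joined-total : ∀ x → ∃[ y ] Joined {n} {r} G x y
  joined-total (u , p)
    -- `p` lies in the cell of some `v`; `a` is its offset in that cell and `b` the number of
    -- positions of the cell after it.
    with cell-exists (λ v → G (u , v)) (<-≤-trans (Fin.toℕ<n p) (≤-reflexive (sym (regularᵁ u))))
  ... | v , lo , hi with m≤n⇒∃[o]m+o≡n lo
  ... | a , ep with m≤n⇒∃[o]m+o≡n (+-cancelˡ-< (laterAtᵁ G (u , v)) a (G (u , v)) (subst (_< _) (sym ep) hi))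
  ... | b , et with join u v et
  ... | _ , q , _ , eq = (v , q) , a , b , sym ep , eq , et

-- `Joined` is total and functional in both directions, the second by transposing `G`; so it is the
-- graph of a bijection.
configuration : ∀ {n r} {G : Multigraph n} → IsRegular r G →
                Σ[ F ∈ Configuration n r ] (∀ x → Joined G x (Inverse.to F x))
configuration {n} {r} {G} reg = mk↔ₛ′ (proj₁ ∘ totalᵁ) (proj₁ ∘ totalⱽ)
    (λ y → joined-functional {G = G} (proj₂ (totalᵁ (proj₁ (totalⱽ y)))) (joined-sym {G = transpose G} (proj₂ (totalⱽ y))))
    (λ x → joined-functional {G = transpose G} (proj₂ (totalⱽ (proj₁ (totalᵁ x)))) (joined-sym {G = G} (proj₂ (totalᵁ x))))
  , proj₂ ∘ totalᵁ
  where
  totalᵁ : ∀ x → ∃[ y ] Joined {n} {r} G x y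
  totalᵁ = joined-total reg
  totalⱽ : ∀ y → ∃[ x ] Joined {n} {r} (transpose G) y x
  totalⱽ = joined-total (transpose-regular reg)

module _ {n r} {G : Multigraph n} (reg : IsRegular r G) (F : Configuration n r) where

  open Inverse F using (to)

  private
    -- With `s = suc a`, the superscript of the copy of `v`, counted from 1, belongs to the position
    -- `j + b` counted from 0.
    subtract : ∀ j a b {t} → suc (a + b) ≡ t → j + t ∸ suc a + 1 ≡ suc (j + b)
    subtract j a b refl = trans (+-comm _ 1) (cong suc (begin
      j + suc (a + b) ∸ suc a    ≡⟨ cong (_∸ suc a) (trans (sym (+-assoc j (suc a) b)) (cong (_+ b) (+-comm j (suc a)))) ⟩
      suc a + j + b ∸ suc a      ≡⟨ cong (_∸ suc a) (+-assoc (suc a) j b) ⟩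
      suc a + (j + b) ∸ suc a    ≡⟨ m+n∸m≡n (suc a) (j + b) ⟩
      j + b                      ∎))
      where open ≡-Reasoning

  -- `IsAssociated` prescribes `F` on the listed pairs; totality of `Joined` shows that every copy
  -- in `U` is listed, which determines `F`.
  associated⇒joined : IsAssociated G F → ∀ x → Joined G x (to x)
  associated⇒joined assoc (u , p) with joined-total reg (u , p)
  ... | (v , q) , j@(a , b , ep , eq , et)
    with assoc u v (suc a) (s≤s z≤n) (≤-trans (s≤s (m≤m+n a b)) (≤-reflexive et))
  ... | p′ , q′ , ep′ , eq′ , Fp′
    with Fin.toℕ-injective (trans (suc-injective (trans ep′ (+-suc _ a))) (sym ep))
       | Fin.toℕ-injective (trans (suc-injective (trans eq′ (subtract (laterAtⱽ G (u , v)) a b et))) (sym eq))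
  ... | refl | refl = subst (Joined G (u , p)) (sym Fp′) j

  joined⇒associated : (∀ x → Joined G x (to x)) → IsAssociated G F
  joined⇒associated joined u v (suc a) _ s≤t with m≤n⇒∃[o]m+o≡n s≤t
  ... | b , et with join reg u v et
  ... | p , q , ep , eq = p , q
    , trans (cong suc ep) (sym (+-suc (laterAtᵁ G (u , v)) a))
    , trans (cong suc eq) (sym (subtract (laterAtⱽ G (u , v)) a b et))
    , joined-functional {G = G} (joined (u , p)) (a , b , ep , eq , et)

-- The configuration determines the cells: the first and the last position of the cell of `v` for
-- `G′` are sent to copies of `v`, so both lie in the cell for `G`, which is therefore at least as
-- long.
joined-multiplicity-≤ : ∀ {n r} {G G′ : Multigraph n} → IsRegular r G′ → {f : Copies n r → Copies n r} →
  (∀ x → Joined G x (f x)) → (∀ x → Joined G′ x (f x)) → ∀ e → G′ e ≤ G e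
joined-multiplicity-≤ {G = G} {G′} reg′ {f} joined joined′ (u , v) with G′ (u , v) in et′
... | zero  = z≤n
... | suc k = +-cancelˡ-< i k (G (u , v)) (≤-<-trans (+-monoˡ-≤ k i≤i′) i′+k<)
  where
  i  = laterAtᵁ G (u , v)
  i′ = laterAtᵁ G′ (u , v)
  in-cell : ∀ a b → suc (a + b) ≡ suc k → InCell (λ v → G (u , v)) v (i′ + a)
  in-cell a b e with join reg′ u v (trans e (sym et′))
  ... | p , q , ep , eq
    with f (u , p) | joined (u , p) | joined-functional {G = G′} (joined′ (u , p)) (a , b , ep , eq , trans e (sym et′))
  ... | .(v , q) | j | refl = subst (InCell (λ v → G (u , v)) v) ep (joined-cell {G = G} j)
  i≤i′ : i ≤ i′
  i≤i′ = subst (i ≤_) (+-identityʳ i′) (proj₁ (in-cell 0 k refl))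
  i′+k< : i′ + k < i + G (u , v)
  i′+k< = proj₂ (in-cell k 0 (cong suc (+-identityʳ k)))

position : ∀ {n r} → Copies n r → Fin (n * r)
position (u , p) = combine u p

Decreasing : ∀ {n r} → Configuration n r → Set
Decreasing F = ∀ u {p p′} → p Fin.< p′ → position (Inverse.to F (u , p′)) Fin.< position (Inverse.to F (u , p))

position-<ʳ : ∀ {n r} (v : Fin n) {q q′ : Fin r} → q Fin.< q′ → combine v q Fin.< combine v q′
position-<ʳ {r = r} v {q} {q′} q<q′ =
  subst₂ _<_ (sym (Fin.toℕ-combine v q)) (sym (Fin.toℕ-combine v q′)) (+-monoʳ-< (r * toℕ v) q<q′)

position-<⁻ʳ : ∀ {n r} (v : Fin n) {q q′ : Fin r} → combine v q Fin.< combine v q′ → q Fin.< q′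
position-<⁻ʳ {r = r} v {q} {q′} lt =
  +-cancelˡ-< (r * toℕ v) _ _ (subst₂ _<_ (Fin.toℕ-combine v q) (Fin.toℕ-combine v q′) lt)

position-<⁻ˡ : ∀ {n r} {v v′ : Fin n} {q q′ : Fin r} → combine v q Fin.< combine v′ q′ → v Fin.≤ v′
position-<⁻ˡ {v = v} {v′} {q} {q′} lt = ≮⇒≥ λ v′<v → <⇒≱ lt (<⇒≤ (Fin.combine-monoˡ-< q′ q v′<v))

-- Later cells belong to earlier vertices of `V`. Within one cell `a + b` is constant, so `b` falls
-- as `a` grows.
joined⇒decreasing : ∀ {n r} {G : Multigraph n} (F : Configuration n r) →
                    (∀ x → Joined G x (Inverse.to F x)) → Decreasing F
joined⇒decreasing {G = G} F joined u {p} {p′} p<p′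
  with Inverse.to F (u , p) | Inverse.to F (u , p′) | joined (u , p) | joined (u , p′)
... | v , q | v′ , q′ | j | j′ with Fin.<-cmp v′ v
... | tri< v′<v _ _ = Fin.combine-monoˡ-< q′ q v′<v
... | tri> _ _ v<v′ = contradiction v<v′ (≤⇒≯
        (cell-order (λ v → G (u , v)) (joined-cell {G = G} j) (joined-cell {G = G} j′) (<⇒≤ p<p′)))
joined⇒decreasing {G = G} F joined u p<p′
    | v , q | .v , q′ | a , b , ep , eq , et | a′ , b′ , ep′ , eq′ , et′ | tri≈ _ refl _ =
  position-<ʳ v (subst₂ _<_ (sym eq′) (sym eq) (+-monoʳ-< (laterAtⱽ G (u , v)) b′<b))
  where
  a<a′ : a < a′
  a<a′ = +-cancelˡ-< (laterAtᵁ G (u , v)) a a′ (subst₂ _<_ ep ep′ p<p′)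
  b′<b : b′ < b
  b′<b = ≰⇒> λ b≤b′ → <-irrefl (trans et (sym et′)) (s≤s (+-mono-<-≤ a<a′ b≤b′))

-- Configurations decreasing on the copies of each vertex

sum-mono : ∀ {n} {f g : Fin n → ℕ} → (∀ i → f i ≤ g i) → sum f ≤ sum g
sum-mono {zero}  le = z≤n
sum-mono {suc n} le = +-mono-≤ (le Fin.zero) (sum-mono (le ∘ Fin.suc))

sum-ones : ∀ n → ∑[ _ < n ] 1 ≡ n
sum-ones zero    = refl
sum-ones (suc n) = cong suc (sum-ones n)

sum-point : ∀ {n} (w : Fin n) (g : Fin n → ℕ) → ∑[ v < n ] (if does (w Fin.≟ v) then g v else 0) ≡ g w
sum-point {suc n} Fin.zero    g = trans (cong (g Fin.zero +_) (sum-replicate-zero n)) (+-identityʳ _)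
sum-point {suc n} (Fin.suc w) g = sum-point w (g ∘ Fin.suc)

sum-if : ∀ b {n} (f : Fin n → ℕ) → (if b then sum f else 0) ≡ ∑[ i < n ] (if b then f i else 0)
sum-if true  f = refl
sum-if false {n} f = sym (sum-replicate-zero n)

if-comm : ∀ b c (k : ℕ) → (if b then (if c then k else 0) else 0) ≡ (if c then (if b then k else 0) else 0)
if-comm true  c     k = refl
if-comm false true  k = refl
if-comm false false k = refl

sum-initial : ∀ {n} k → k ≤ n → ∑[ i < n ] (if does (toℕ i <? k) then 1 else 0) ≡ k
sum-initial {n}     zero    _         = sum-replicate-zero n
sum-initial {suc n} (suc k) (s≤s k≤n) = cong suc (sum-initial k k≤n)

count : ∀ {n r} → (Fin r → Fin n) → Fin n → ℕ
count {r = r} f v = ∑[ p < r ] (if does (f p Fin.≟ v) then 1 else 0)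

-- Double counting of the pairs `p`, `v′` with `f p ≡ v′` and `v′` after `v`.
count-later : ∀ {n r} (f : Fin r → Fin n) v →
              later (count f) v ≡ ∑[ p < r ] (if does (v Fin.<? f p) then 1 else 0)
count-later {n} {r} f v = begin
  ∑[ v′ < n ] (if after v′ then ∑[ p < r ] [ p at v′ ] else 0)     ≡⟨ sum-cong-≗ (λ v′ → sum-if (after v′) (λ p → [ p at v′ ])) ⟩
  ∑[ v′ < n ] ∑[ p < r ] (if after v′ then [ p at v′ ] else 0)     ≡⟨ ∑-comm (λ v′ p → if after v′ then [ p at v′ ] else 0) ⟩
  ∑[ p < r ] ∑[ v′ < n ] (if after v′ then [ p at v′ ] else 0)     ≡⟨ sum-cong-≗ (λ p → sum-cong-≗ (λ v′ → if-comm (after v′) (does (f p Fin.≟ v′)) 1)) ⟩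
  ∑[ p < r ] ∑[ v′ < n ] (if does (f p Fin.≟ v′) then (if after v′ then 1 else 0) else 0)
                                                                    ≡⟨ sum-cong-≗ (λ p → sum-point (f p) (λ v′ → if after v′ then 1 else 0)) ⟩
  ∑[ p < r ] (if after (f p) then 1 else 0)                         ∎
  where
  open ≡-Reasoning
  after : Fin n → Bool
  after v′ = does (v Fin.<? v′)
  [_at_] : Fin r → Fin n → ℕ
  [ p at v′ ] = if does (f p Fin.≟ v′) then 1 else 0

count-total : ∀ {n r} (f : Fin r → Fin n) → ∑[ v < n ] count f v ≡ r
count-total {n} {r} f = begin
  ∑[ v < n ] ∑[ p < r ] (if does (f p Fin.≟ v) then 1 else 0)    ≡⟨ ∑-comm (λ v p → if does (f p Fin.≟ v) then 1 else 0) ⟩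
  ∑[ p < r ] ∑[ v < n ] (if does (f p Fin.≟ v) then 1 else 0)    ≡⟨ sum-cong-≗ (λ p → sum-point (f p) (λ _ → 1)) ⟩
  ∑[ p < r ] 1                                                   ≡⟨ sum-ones r ⟩
  r                                                              ∎
  where open ≡-Reasoning

-- As `f` is antitone, every position with a value after `f p` precedes `p`, which gives the lower
-- bound; every position up to `p` has the value `f p` or a later one, which gives the upper bound.
count-cell : ∀ {n r} (f : Fin r → Fin n) → (∀ {p p′} → p Fin.≤ p′ → f p′ Fin.≤ f p) →
             ∀ p → InCell (count f) (f p) (toℕ p)
count-cell {n} {r} f antitone p = lower , upper
  where
  open ≤-Reasoning
  above : Fin r → ℕ
  above p′ = if does (f p Fin.<? f p′) then 1 else 0
  level : Fin r → ℕ
  level p′ = if does (f p′ Fin.≟ f p) then 1 else 0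
  lower : later (count f) (f p) ≤ toℕ p
  lower = begin
    later (count f) (f p)                                        ≡⟨ count-later f (f p) ⟩
    ∑[ p′ < r ] above p′                                         ≤⟨ sum-mono (λ p′ → indicator-mono (f p Fin.<? f p′) (toℕ p′ <? toℕ p)
                                                                      (λ fp<fp′ → ≰⇒> λ p≤p′ → <⇒≱ fp<fp′ (antitone p≤p′))) ⟩
    ∑[ p′ < r ] (if does (toℕ p′ <? toℕ p) then 1 else 0)        ≡⟨ sum-initial (toℕ p) (<⇒≤ (Fin.toℕ<n p)) ⟩
    toℕ p                                                        ∎
  here-or-above : ∀ p′ → (if does (toℕ p′ <? suc (toℕ p)) then 1 else 0) ≤ above p′ + level p′
  here-or-above p′ with f p Fin.<? f p′
  ... | yes fp<fp′ rewrite if-yes {x = 1} {0} (f p Fin.<? f p′) fp<fp′ =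
    m≤n⇒m≤n+o (level p′) (indicator-mono (toℕ p′ <? suc (toℕ p)) (yes fp<fp′) (λ _ → fp<fp′))
  ... | no fp≮fp′ = ≤-trans (indicator-mono (toℕ p′ <? suc (toℕ p)) (f p′ Fin.≟ f p)
    (λ p′≤p → Fin.≤-antisym (≮⇒≥ fp≮fp′) (antitone (s≤s⁻¹ p′≤p)))) (m≤n+m (level p′) (above p′))
  upper : toℕ p < later (count f) (f p) + count f (f p)
  upper = begin
    suc (toℕ p)                                                  ≡⟨ sum-initial (suc (toℕ p)) (Fin.toℕ<n p) ⟨
    ∑[ p′ < r ] (if does (toℕ p′ <? suc (toℕ p)) then 1 else 0)  ≤⟨ sum-mono here-or-above ⟩
    ∑[ p′ < r ] (above p′ + level p′)                            ≡⟨ ∑-distrib-+ above level ⟩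
    ∑[ p′ < r ] above p′ + ∑[ p′ < r ] level p′                  ≡⟨ cong (_+ count f (f p)) (count-later f (f p)) ⟨
    later (count f) (f p) + count f (f p)                        ∎

-- The multigraph left when the superscripts in the pairs of `F` are forgotten.
multiplicity : ∀ {n r} → Configuration n r → Multigraph n
multiplicity F (u , v) = count (λ p → proj₁ (Inverse.to F (u , p))) v

module _ {n r} (F : Configuration n r) where

  open Inverse F using (to; from)

  -- Both sides count the pairs of `F` between copies of `u` and copies of `v`, once along each
  -- side.
  multiplicity-sym : ∀ u v → multiplicity F (u , v) ≡ multiplicity (↔-sym F) (v , u)
  multiplicity-sym u v = begin
    ∑[ p < r ] (if does (proj₁ (to (u , p)) Fin.≟ v) then 1 else 0)     ≡⟨ sum-cong-≗ (λ p → expand (to (u , p)) v) ⟩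
    ∑[ p < r ] ∑[ q < r ] [ to (u , p) is v , q ]                       ≡⟨ ∑-comm (λ p q → [ to (u , p) is v , q ]) ⟩
    ∑[ q < r ] ∑[ p < r ] [ to (u , p) is v , q ]                       ≡⟨ sum-cong-≗ (λ q → sum-cong-≗ (λ p → swap p q)) ⟩
    ∑[ q < r ] ∑[ p < r ] [ from (v , q) is u , p ]                     ≡⟨ sum-cong-≗ (λ q → expand (from (v , q)) u) ⟨
    ∑[ q < r ] (if does (proj₁ (from (v , q)) Fin.≟ u) then 1 else 0)   ∎
    where
    open ≡-Reasoning
    [_is_,_] : Copies n r → Fin n → Fin r → ℕ
    [ x is v , q ] = if does (proj₁ x Fin.≟ v) then (if does (proj₂ x Fin.≟ q) then 1 else 0) else 0
    expand : ∀ x v → (if does (proj₁ x Fin.≟ v) then 1 else 0) ≡ ∑[ q < r ] [ x is v , q ]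
    expand x v = trans
      (cong (λ k → if does (proj₁ x Fin.≟ v) then k else 0) (sym (sum-point (proj₂ x) (λ _ → 1))))
      (sum-if (does (proj₁ x Fin.≟ v)) (λ q → if does (proj₂ x Fin.≟ q) then 1 else 0))
    yes-is : ∀ x {v q} → x ≡ (v , q) → [ x is v , q ] ≡ 1
    yes-is (v , q) refl = trans (if-yes (v Fin.≟ v) refl) (if-yes (q Fin.≟ q) refl)
    no-is : ∀ x {v q} → x ≢ (v , q) → [ x is v , q ] ≡ 0
    no-is (v′ , q′) {v} {q} ne with v′ Fin.≟ v
    ... | no  _    = refl
    ... | yes refl = if-no (q′ Fin.≟ q) λ { refl → ne refl }
    swap : ∀ p q → [ to (u , p) is v , q ] ≡ [ from (v , q) is u , p ]
    swap p q with Product.≡-dec Fin._≟_ Fin._≟_ (to (u , p)) (v , q)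
    ... | yes e = trans (yes-is _ e) (sym (yes-is _ (Inverse.inverseʳ F (sym e))))
    ... | no ne = trans (no-is _ ne) (sym (no-is _ λ e → ne (Inverse.inverseˡ F (sym e))))

  multiplicity-regular : IsRegular r (multiplicity F)
  multiplicity-regular = record
    { regularᵁ = λ u → count-total (λ p → proj₁ (to (u , p)))
    ; regularⱽ = λ v → trans (sum-cong-≗ (λ u → multiplicity-sym u v)) (count-total (λ q → proj₁ (from (v , q))))
    }

decreasing⇒cell : ∀ {n r} (F : Configuration n r) → Decreasing F → ∀ {u v p q} → Inverse.to F (u , p) ≡ (v , q) →
                  InCell (λ v → multiplicity F (u , v)) v (toℕ p)
decreasing⇒cell F dec {u} {v} {p} e =
  subst (λ v → InCell (λ v → multiplicity F (u , v)) v (toℕ p)) (cong proj₁ e)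
    (count-cell (λ p → proj₁ (Inverse.to F (u , p))) antitone p)
  where
  antitone : ∀ {p p′} → p Fin.≤ p′ → proj₁ (Inverse.to F (u , p′)) Fin.≤ proj₁ (Inverse.to F (u , p))
  antitone {p} {p′} p≤p′ with Fin.<-cmp p p′
  ... | tri< p<p′ _ _ = position-<⁻ˡ (dec u p<p′)
  ... | tri≈ _ refl _ = ≤-refl
  ... | tri> _ _ p′<p = contradiction p′<p (≤⇒≯ p≤p′)

-- For fixed `u` and `v`, `F` maps one interval of length `t` decreasingly into another, so it is
-- the reversal. `upper` steps through the interval from its start and bounds `q` from above;
-- `lower` steps from its end and bounds `q` from below.
decreasing⇒joined : ∀ {n r} (F : Configuration n r) → Decreasing F → Decreasing (↔-sym F) →
                    ∀ x → Joined (multiplicity F) x (Inverse.to F x)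
decreasing⇒joined {n} {r} F decᵁ decⱽ (u , p₀) = joined (to (u , p₀)) refl
  where
  open Inverse F using (to; from)
  G = multiplicity F
  module _ (v : Fin n) where
    i = laterAtᵁ G (u , v)
    j = laterAtⱽ G (u , v)
    t = G (u , v)

    cellᵁ : ∀ {p q} → to (u , p) ≡ (v , q) → InCell (λ v → G (u , v)) v (toℕ p)
    cellᵁ = decreasing⇒cell F decᵁ

    cellⱽ : ∀ {p q} → to (u , p) ≡ (v , q) → InCell (λ u → G (u , v)) u (toℕ q)
    cellⱽ {p} {q} e with decreasing⇒cell (↔-sym F) decⱽ (Inverse.inverseʳ F (sym e))
    ... | lo , hi rewrite sym (multiplicity-sym F u v) | sym (later-cong (λ u → multiplicity-sym F u v) u) = lo , hi

    in-cell : ∀ p → InCell (λ v → G (u , v)) v (toℕ p) → ∃[ q ] to (u , p) ≡ (v , q)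
    in-cell p c with to (u , p) in e
    ... | v′ , q with cell-unique (λ v → G (u , v)) (decreasing⇒cell F decᵁ e) c
    ... | refl = q , refl

    descend : ∀ {p p′ q q′} → to (u , p) ≡ (v , q) → to (u , p′) ≡ (v , q′) → p Fin.< p′ → q′ Fin.< q
    descend e e′ p<p′ = position-<⁻ʳ v (subst₂ (λ x y → position x Fin.< position y) e′ e (decᵁ u p<p′))

    upper : ∀ a p q → to (u , p) ≡ (v , q) → toℕ p ≡ i + a → toℕ q + suc a ≤ j + t
    upper zero    p q e ep = subst (_≤ j + t) (+-comm 1 (toℕ q)) (proj₂ (cellⱽ e))
    upper (suc a) p q e ep with in-cell p⁻ c⁻
      where
      p⁻< : i + a < r
      p⁻< = <-trans (+-monoʳ-< i (n<1+n a)) (subst (_< r) ep (Fin.toℕ<n p))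
      p⁻ = fromℕ< p⁻<
      ep⁻ = Fin.toℕ-fromℕ< p⁻<
      c⁻ : InCell (λ v → G (u , v)) v (toℕ p⁻)
      c⁻ rewrite ep⁻ = m≤m+n i a , <-trans (+-monoʳ-< i (n<1+n a)) (subst (_< i + t) ep (proj₂ (cellᵁ e)))
    ... | q⁻ , e⁻ = begin
      toℕ q + suc (suc a)    ≡⟨ +-suc (toℕ q) (suc a) ⟩
      suc (toℕ q) + suc a    ≤⟨ +-monoˡ-≤ (suc a) (descend e⁻ e (subst₂ _<_ (sym (Fin.toℕ-fromℕ< _)) (sym ep) (+-monoʳ-< i (n<1+n a)))) ⟩
      toℕ q⁻ + suc a         ≤⟨ upper a _ q⁻ e⁻ (Fin.toℕ-fromℕ< _) ⟩
      j + t                  ∎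
      where open ≤-Reasoning

    lower : ∀ b p q → to (u , p) ≡ (v , q) → toℕ p + suc b ≡ i + t → j + b ≤ toℕ q
    lower zero    p q e ep = subst (_≤ toℕ q) (sym (+-identityʳ j)) (proj₁ (cellⱽ e))
    lower (suc b) p q e ep with in-cell p⁺ c⁺
      where
      p⁺<t : suc (toℕ p) < i + t
      p⁺<t = subst (suc (toℕ p) <_) (trans (sym (+-suc (toℕ p) (suc b))) ep) (s≤s (subst (_< toℕ p + suc b) (+-identityʳ _) (+-monoʳ-< (toℕ p) (s≤s z≤n))))
      p⁺< : suc (toℕ p) < r
      p⁺< = <-≤-trans p⁺<t (≤-trans (cell-bound (λ v → G (u , v)) v) (≤-reflexive (IsRegular.regularᵁ (multiplicity-regular F) u)))
      p⁺ = fromℕ< p⁺<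
      c⁺ : InCell (λ v → G (u , v)) v (toℕ p⁺)
      c⁺ rewrite Fin.toℕ-fromℕ< p⁺< = m≤n⇒m≤1+n (proj₁ (cellᵁ e)) , p⁺<t
    ... | q⁺ , e⁺ = begin
      j + suc b          ≡⟨ +-suc j b ⟩
      suc (j + b)        ≤⟨ s≤s (lower b _ q⁺ e⁺ (trans (cong (_+ suc b) (Fin.toℕ-fromℕ< _)) (trans (sym (+-suc (toℕ p) (suc b))) ep))) ⟩
      suc (toℕ q⁺)       ≤⟨ descend e e⁺ (≤-reflexive (sym (Fin.toℕ-fromℕ< _))) ⟩
      toℕ q              ∎
      where open ≤-Reasoning

  joined : ∀ {p} y → to (u , p) ≡ y → Joined G (u , p) y
  joined {p} (v , q) e with m≤n⇒∃[o]m+o≡n (proj₁ (cellᵁ v e))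
  ... | a , ep with m≤n⇒∃[o]m+o≡n (+-cancelˡ-< (i v) a (t v) (subst (_< i v + t v) (sym ep) (proj₂ (cellᵁ v e))))
  ... | b , et = a , b , sym ep , ≤-antisym q≤ q≥ , et
    where
    q≥ : j v + b ≤ toℕ q
    q≥ = lower v b p q e (trans (cong (_+ suc b) (sym ep)) (trans (+-assoc (i v) a (suc b)) (cong (i v +_) (trans (+-suc a b) et))))
    q≤ : toℕ q ≤ j v + b
    q≤ = +-cancelʳ-≤ (suc a) (toℕ q) (j v + b) (subst (toℕ q + suc a ≤_)
      (trans (cong (j v +_) (trans (sym et) (+-comm (suc a) b))) (sym (+-assoc (j v) b (suc a)))) (upper v a p q e (sym ep)))

-- Condition (T) and planar matchings

module _ {n r} (F : Configuration n r) where

  open Inverse F using (to; from)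

  σ-to : ∀ x → σ F ⟨$⟩ʳ position x ≡ position (to x)
  σ-to (u , p) = cong (position ∘ to) (Fin.remQuot-combine u p)

  σ-from : ∀ y → σ F ⟨$⟩ˡ position y ≡ position (from y)
  σ-from (v , q) = cong (position ∘ from) (Fin.remQuot-combine v q)

σ-injective : ∀ {n r} (F F′ : Configuration n r) → σ F ⟨$⟩ʳ_ ≗ σ F′ ⟨$⟩ʳ_ → Inverse.to F ≗ Inverse.to F′
σ-injective F F′ eq x@(u , p) =
  let eqˡ , eqʳ = Fin.combine-injective _ _ _ _ (trans (sym (σ-to F x)) (trans (eq (position x)) (σ-to F′ x)))
  in cong₂ _,_ eqˡ eqʳ

-- Condition (T) in terms of successive copies counted from 0, the form in which the lemmas on
-- descents apply.
RowsDescend : (n r : ℕ) → Tableau → Set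
RowsDescend n r T = ∀ (u : Fin n) {p p′ : Fin r} → toℕ p′ ≡ suc (toℕ p) →
  RowStrictlyAbove T (suc (toℕ (combine u p))) (suc (toℕ (combine u p′)))

rowsDescend⇒conditionT : ∀ {n r T} → RowsDescend n r T → ConditionT n r T
rowsDescend⇒conditionT {n} {r} {T} desc u (suc s) _ s<r =
  subst₂ (RowStrictlyAbove T) lower upper (desc u succ)
  where
  p  = fromℕ< (<-trans (n<1+n s) s<r)
  p′ = fromℕ< s<r
  succ : toℕ p′ ≡ suc (toℕ p)
  succ = trans (Fin.toℕ-fromℕ< s<r) (cong suc (sym (Fin.toℕ-fromℕ< _)))
  lower : suc (toℕ (combine u p)) ≡ r * toℕ u + suc s
  lower = trans (cong suc (trans (Fin.toℕ-combine u p) (cong (r * toℕ u +_) (Fin.toℕ-fromℕ< _)))) (sym (+-suc _ s))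
  upper : suc (toℕ (combine u p′)) ≡ r * toℕ u + suc s + 1
  upper = trans (cong suc (trans (Fin.toℕ-combine u p′) (cong (r * toℕ u +_) (Fin.toℕ-fromℕ< s<r)))) (+-comm 1 _)

conditionT⇒rowsDescend : ∀ {n r T} → ConditionT n r T → RowsDescend n r T
conditionT⇒rowsDescend {n} {r} {T} cond u {p} {p′} succ =
  subst₂ (RowStrictlyAbove T) lower upper
    (cond u (suc (toℕ p)) (s≤s z≤n) (subst (_< r) succ (Fin.toℕ<n p′)))
  where
  lower : r * toℕ u + suc (toℕ p) ≡ suc (toℕ (combine u p))
  lower = trans (+-suc _ (toℕ p)) (cong suc (sym (Fin.toℕ-combine u p)))
  upper : r * toℕ u + suc (toℕ p) + 1 ≡ suc (toℕ (combine u p′))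
  upper = trans (+-comm _ 1) (cong suc (trans (cong (r * toℕ u +_) (sym succ)) (sym (Fin.toℕ-combine u p′))))

combine-suc : ∀ {n r} (u : Fin n) {p p′ : Fin r} → toℕ p′ ≡ suc (toℕ p) →
              toℕ (combine u p′) ≡ suc (toℕ (combine u p))
combine-suc {r = r} u {p} {p′} succ = begin
  toℕ (combine u p′)               ≡⟨ Fin.toℕ-combine u p′ ⟩
  r * toℕ u + toℕ p′               ≡⟨ cong (r * toℕ u +_) succ ⟩
  r * toℕ u + suc (toℕ p)          ≡⟨ +-suc _ (toℕ p) ⟩
  suc (r * toℕ u + toℕ p)          ≡⟨ cong suc (Fin.toℕ-combine u p) ⟨
  suc (toℕ (combine u p))          ∎
  where open ≡-Reasoning

adjacent⇒antitone : ∀ {r k} (f : Fin r → Fin k) →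
  (∀ {p p′} → toℕ p′ ≡ suc (toℕ p) → f p′ Fin.< f p) → ∀ {p p′} → p Fin.< p′ → f p′ Fin.< f p
adjacent⇒antitone {r} f adj {p} {p′} p<p′ with m≤n⇒∃[o]m+o≡n p<p′
... | d , eq = go d eq
  where
  go : ∀ d {p′} → suc (toℕ p) + d ≡ toℕ p′ → f p′ Fin.< f p
  go zero    eq = adj (trans (sym eq) (cong suc (+-identityʳ _)))
  go (suc d) {p′} eq = <-trans (adj succ) (go d (sym (Fin.toℕ-fromℕ< q<r)))
    where
    q<r : suc (toℕ p) + d < r
    q<r = <-trans (≤-reflexive (trans (sym (+-suc _ d)) eq)) (Fin.toℕ<n p′)
    succ : toℕ p′ ≡ suc (toℕ (fromℕ< q<r))
    succ = trans (sym eq) (trans (+-suc _ d) (cong suc (sym (Fin.toℕ-fromℕ< q<r))))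

module _ {n r} (F : Configuration n r) where

  private
    P = proj₁ (RSK (σ F))
    Q = proj₂ (RSK (σ F))

  decreasing⇒conditionQ : Decreasing F → ConditionT n r Q
  decreasing⇒conditionQ dec = rowsDescend⇒conditionT {n} {r} λ u {p} {p′} succ →
    recording-descent⁺ (σ F) (combine-suc u succ)
      (subst₂ Fin._<_ (sym (σ-to F (u , p′))) (sym (σ-to F (u , p))) (dec u (≤-reflexive (sym succ))))

  conditionQ⇒decreasing : ConditionT n r Q → Decreasing F
  conditionQ⇒decreasing cond u = adjacent⇒antitone (λ p → position (Inverse.to F (u , p))) λ {p} {p′} succ →
    subst₂ Fin._<_ (σ-to F (u , p′)) (σ-to F (u , p))
      (recording-descent⁻ (σ F) (combine-suc u succ) (conditionT⇒rowsDescend {n} {r} cond u succ))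

  decreasing⇒conditionP : Decreasing (↔-sym F) → ConditionT n r P
  decreasing⇒conditionP dec = rowsDescend⇒conditionT {n} {r} λ v {q} {q′} succ →
    insertion-descent⁺ (σ F) (combine-suc v succ)
      (subst₂ Fin._<_ (sym (σ-from F (v , q′))) (sym (σ-from F (v , q))) (dec v (≤-reflexive (sym succ))))

  conditionP⇒decreasing : ConditionT n r P → Decreasing (↔-sym F)
  conditionP⇒decreasing cond v = adjacent⇒antitone (λ q → position (Inverse.from F (v , q))) λ {q} {q′} succ →
    subst₂ Fin._<_ (σ-from F (v , q′)) (σ-from F (v , q))
      (insertion-descent⁻ (σ F) (combine-suc v succ) (conditionT⇒rowsDescend {n} {r} cond v succ))

joined-symᶠ : ∀ {n r} {G : Multigraph n} (F : Configuration n r) → (∀ x → Joined G x (Inverse.to F x)) →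
              ∀ y → Joined (transpose G) y (Inverse.from F y)
joined-symᶠ {G = G} F joined y =
  joined-sym {G = G} (subst (Joined G (Inverse.from F y)) (Inverse.inverseˡ F refl) (joined (Inverse.from F y)))

module _ {n r} {G : Multigraph n} (reg : IsRegular r G) (F : Configuration n r)
         (joined : ∀ x → Joined G x (Inverse.to F x)) where

  open Inverse F using (to; from)

  private
    edge : Copies n r → Edge n
    edge x = proj₁ x , proj₁ (to x)

    edge-multiplicity : ∀ x → 1 ≤ G (edge x)
    edge-multiplicity x with joined x
    ... | _ , _ , _ , _ , et = ≤-trans (s≤s z≤n) (≤-reflexive et)

    -- Copies of one vertex have their partners in reversed order, so an increasing pair involves
    -- two different vertices on each side.
    increasing⇒noncrossing : ∀ {x y} → Increasing (σ F) (position x) (position y) →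
                             proj₁ x Fin.< proj₁ y × proj₁ (to x) Fin.< proj₁ (to y)
    increasing⇒noncrossing {x@(u , p)} {y@(u′ , p′)} (x<y , σx<σy) = u<u′ , v<v′
      where
      tx<ty : position (to x) Fin.< position (to y)
      tx<ty = subst₂ Fin._<_ (σ-to F x) (σ-to F y) σx<σy
      u<u′ : u Fin.< u′
      u<u′ = ≤∧≢⇒< (position-<⁻ˡ x<y) λ eq → case Fin.toℕ-injective eq of λ
        { refl → <-asym tx<ty (joined⇒decreasing {G = G} F joined u (position-<⁻ʳ u x<y)) }
      v<v′ : proj₁ (to x) Fin.< proj₁ (to y)
      v<v′ with to x in ex | to y in ey | tx<ty
      ... | v , q | v′ , q′ | lt = ≤∧≢⇒< (position-<⁻ˡ lt) λ eq → case Fin.toℕ-injective eq of λ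
        { refl → <-asym x<y (subst₂ (λ a b → position a Fin.< position b)
            (Inverse.inverseʳ F (sym ey)) (Inverse.inverseʳ F (sym ex))
            (joined⇒decreasing {G = transpose G} (↔-sym F) (joined-symᶠ {G = G} F joined) v (position-<⁻ʳ v lt))) }

    noncrossing⇒increasing : ∀ {x y} → proj₁ x Fin.< proj₁ y → proj₁ (to x) Fin.< proj₁ (to y) →
                             Increasing (σ F) (position x) (position y)
    noncrossing⇒increasing {x} {y} u<u′ v<v′ = Fin.combine-monoˡ-< _ _ u<u′
      , subst₂ Fin._<_ (sym (σ-to F x)) (sym (σ-to F y)) (Fin.combine-monoˡ-< _ _ v<v′)

    copy : Fin (n * r) → Copies n r
    copy = remQuot r

    position-copy : ∀ i → position {n} (copy i) ≡ i
    position-copy = Fin.combine-remQuot {n} r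

    edge-copy : ∀ {e} → 1 ≤ G e → ∃[ x ] edge x ≡ e
    edge-copy {u , v} 1≤ with m≤n⇒∃[o]m+o≡n 1≤
    ... | b , et with join reg u v et
    ... | p , q , ep , eq = (u , p)
      -- The offset 0 chooses the first copy of `u` in the interval of the edge.
      , cong (λ y → u , proj₁ y) (joined-functional {G = G} (joined (u , p)) (0 , b , ep , eq , et))

  -- A longest increasing subsequence projects to a planar matching. Conversely, copies chosen for
  -- the edges of a planar matching are pairwise increasing in one order or the other, so their
  -- colours are distinct.
  isL : IsL G (width (σ F))
  isL = record { attained = attained ; maximal = maximal }
    where
    attained : ∃[ M ] (IsPlanarMatching G M × length M ≡ width (σ F))
    attained with increasing-subsequence (σ F)
    ... | s , increasing , e = map (edge ∘ copy) s
      , record { edges = All.map⁺ (All.universal (edge-multiplicity ∘ copy) s)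
               -- The subsequence is listed from its last term to its first, hence `inj₂`.
               ; noncrossing = AllPairs.map⁺ (AllPairs.map (λ {i} {j} inc → inj₂ (increasing⇒noncrossing
                   (subst₂ (Increasing (σ F)) (sym (position-copy j)) (sym (position-copy i)) inc))) increasing) }
      , trans (length-map (edge ∘ copy) s) e
    maximal : ∀ M → IsPlanarMatching G M → length M ≤ width (σ F)
    maximal M planar with colouring (σ F)
    ... | colour , bound , mono = Fin.injective⇒≤ colour-injective
      where
      open IsPlanarMatching planar
      copies : ∀ i → ∃[ x ] edge x ≡ lookup M i
      copies i = edge-copy (All.lookup edges (∈.∈-lookup i))
      colourᴹ : Fin (length M) → Fin (width (σ F))
      colourᴹ i = fromℕ< (bound (position (proj₁ (copies i))))
      distinct : ∀ {i j} → i Fin.< j → colourᴹ i ≢ colourᴹ j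
      distinct {i} {j} i<j eq = different
        (subst₂ NonCrossing (sym (proj₂ (copies i))) (sym (proj₂ (copies j))) (allPairs-lookup noncrossing i<j))
        (Fin.fromℕ<-injective _ _ _ _ eq)
        where
        different : ∀ {x y} → NonCrossing (edge x) (edge y) → colour (position x) ≢ colour (position y)
        different (inj₁ (u< , v<)) = <⇒≢ (mono (noncrossing⇒increasing u< v<))
        different (inj₂ (u< , v<)) = <⇒≢ (mono (noncrossing⇒increasing u< v<)) ∘ sym
      colour-injective : ∀ {i j} → colourᴹ i ≡ colourᴹ j → i ≡ j
      colour-injective {i} {j} eq with Fin.<-cmp i j
      ... | tri< i<j _ _ = contradiction eq (distinct i<j)
      ... | tri≈ _ i≡j _ = i≡j
      ... | tri> _ _ j<i = contradiction (sym eq) (distinct j<i)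

-- The bijection and the cardinalities

isL-width-≤ : ∀ {n r d} {G : Multigraph n} (inG : InG r d G) (F : Configuration n r) →
              (∀ x → Joined G x (Inverse.to F x)) → width (σ F) ≤ d
isL-width-≤ {G = G} inG F joined =
  let ℓ , isLℓ , ℓ≤d = L≤d
      M , planar , len = IsL.attained (isL {G = G} regular F joined)
  in ≤-trans (subst (_≤ ℓ) len (IsL.maximal isLℓ M planar)) ℓ≤d
  where open InG inG

inPairs : ∀ {n r d} (F : Configuration n r) → InḠ d F → InPairs n r d (RSK (σ F))
inPairs {n} {r} {d} F (G , inG , assoc) = record
  { sameShape  = sameShape
  ; P∈T        = record { standard = RSK-standardˡ (σ F) ; columns≤d = P≤d }
  ; Q∈T        = record { standard = RSK-standardʳ (σ F)
                        ; columns≤d = All.map⁻ (subst (All (_≤ d)) sameShape (All.map⁺ P≤d)) }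
  ; conditionP = decreasing⇒conditionP F (joined⇒decreasing {G = transpose G} (↔-sym F) (joined-symᶠ {G = G} F joined))
  ; conditionQ = decreasing⇒conditionQ F (joined⇒decreasing {G = G} F joined)
  }
  where
  joined : ∀ x → Joined G x (Inverse.to F x)
  joined = associated⇒joined (InG.regular inG) F assoc
  sameShape = run-shape (run-RSK (σ F))
  P≤d = rows-≤ (run-SSYTˡ (run-RSK (σ F))) (isL-width-≤ inG F joined)

inPairs⇒inḠ : ∀ {n r d} (F : Configuration n r) → InPairs n r d (RSK (σ F)) → InḠ d F
inPairs⇒inḠ F pairs = multiplicity F
  , record { regular = regular
           ; L≤d = width (σ F) , isL regular F joined , firstRow-≤ (InT.columns≤d P∈T) }
  , joined⇒associated regular F joined
  where
  open InPairs pairs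
  regular = multiplicity-regular F
  joined = decreasing⇒joined F (conditionQ⇒decreasing F conditionQ) (conditionP⇒decreasing F conditionP)

toConfiguration : ∀ n r → Permutation′ (n * r) → Configuration n r
toConfiguration n r π = Fin.*↔× {n} {r} ↔-∘ (π ↔-∘ ↔-sym (Fin.*↔× {n} {r}))

σ-toConfiguration : ∀ n r (π : Permutation′ (n * r)) → σ (toConfiguration n r π) ⟨$⟩ʳ_ ≗ π ⟨$⟩ʳ_
σ-toConfiguration n r π i = trans (Fin.combine-remQuot {n} r _) (cong (π ⟨$⟩ʳ_) (Fin.combine-remQuot {n} r i))

RSK-bijection : ∀ n r d → Bijection (𝒢̄ n r d) (TableauPairs n r d)
RSK-bijection n r d = record
  { to        = λ (F , inḠ) → RSK (σ F) , inPairs F inḠ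
  ; cong      = λ {x} {y} → cong-σ (proj₁ x) (proj₁ y)
  ; bijective = (λ {x} {y} eq → σ-injective (proj₁ x) (proj₁ y) (RSK-injective (σ (proj₁ x)) (σ (proj₁ y)) eq)) , surjective
  }
  where
  cong-σ : (F F′ : Configuration n r) → Inverse.to F ≗ Inverse.to F′ → RSK (σ F) ≡ RSK (σ F′)
  cong-σ F F′ eq = RSK-cong (σ F) (σ F′) λ i → cong position (eq (remQuot r i))
  surjective : ∀ PQ → Σ[ F ∈ Σ (Configuration n r) (InḠ d) ]
               (∀ {F′ : Σ (Configuration n r) (InḠ d)} → Inverse.to (proj₁ F′) ≗ Inverse.to (proj₁ F) → RSK (σ (proj₁ F′)) ≡ proj₁ PQ)
  surjective ((P , Q) , pairs) with RSK-surjective (InT.standard P∈T) (InT.standard Q∈T) sameShape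
    where open InPairs pairs
  ... | π , e = (F , inPairs⇒inḠ F (subst (InPairs n r d) (sym RSK-F) pairs))
              , λ {F′} eq → trans (cong-σ (proj₁ F′) F eq) RSK-F
    where
    F = toConfiguration n r π
    RSK-F : RSK (σ F) ≡ (P , Q)
    RSK-F = trans (RSK-cong (σ F) π (σ-toConfiguration n r π)) e

module _ {n r} {G G′ : Multigraph n} (reg : IsRegular r G) (reg′ : IsRegular r G′) (F F′ : Configuration n r)
         (assoc : IsAssociated G F) (assoc′ : IsAssociated G′ F′) where

  associated-functional : G ≗ G′ → Inverse.to F ≗ Inverse.to F′
  associated-functional eq x = joined-functional {G = G′}
    (joined-resp {G = G} eq (associated⇒joined reg F assoc x)) (associated⇒joined reg′ F′ assoc′ x)

  associated-injective : Inverse.to F ≗ Inverse.to F′ → G ≗ G′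
  associated-injective eq e = ≤-antisym
    (joined-multiplicity-≤ {G = G′} reg joined′ joined e)
    (joined-multiplicity-≤ {G = G} reg′ joined joined′ e)
    where
    joined : ∀ x → Joined G x (Inverse.to F x)
    joined = associated⇒joined reg F assoc
    joined′ : ∀ x → Joined G′ x (Inverse.to F x)
    joined′ x = subst (Joined G′ x) (sym (eq x)) (associated⇒joined reg′ F′ assoc′ x)

-- `from` returns the multigraph stored in the membership proof. Equality ignores such proofs, so
-- `associated-injective` is what makes `from` respect it.
𝒢↔𝒢̄ : ∀ n r d → Inverse (𝒢 n r d) (𝒢̄ n r d)
𝒢↔𝒢̄ n r d = record
  { to        = to
  ; from      = from
  ; to-cong   = λ {x} {y} → to-unique x y {proj₁ (to y)} (proj₂ (proj₂ (proj₂ (to y))))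
  ; from-cong = λ {x} {y} eq → from-unique x y eq
  ; inverse   = (λ {x} {y} eq → to-unique y (from x) {proj₁ x} (proj₂ (proj₂ (proj₂ x))) eq)
              , (λ {x} {y} eq → from-unique y (to x) eq)
  }
  where
  open InG using (regular)
  to : Σ (Multigraph n) (InG r d) → Σ (Configuration n r) (InḠ d)
  to (G , inG) = let F , joined = configuration (regular inG) in
    F , G , inG , joined⇒associated (regular inG) F joined
  from : Σ (Configuration n r) (InḠ d) → Σ (Multigraph n) (InG r d)
  from (_ , G , inG , _) = G , inG
  to-unique : ∀ x y {F} → IsAssociated (proj₁ y) F → proj₁ x ≗ proj₁ y → Inverse.to (proj₁ (to x)) ≗ Inverse.to F
  to-unique x y {F} assoc = associated-functional (regular (proj₂ x)) (regular (proj₂ y)) (proj₁ (to x)) F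
    (proj₂ (proj₂ (proj₂ (to x)))) assoc
  from-unique : ∀ x y → Inverse.to (proj₁ x) ≗ Inverse.to (proj₁ y) → proj₁ (from x) ≗ proj₁ (from y)
  from-unique (F , _ , inG , assoc) (F′ , _ , inG′ , assoc′) =
    associated-injective (regular inG) (regular inG′) F F′ assoc assoc′

-- Finiteness of the set of multigraphs

inG-resp : ∀ {n r d} {G G′ : Multigraph n} → G ≗ G′ → InG r d G → InG r d G′
inG-resp {G = G} {G′} eq inG = record
  { regular = record
    { regularᵁ = λ u → trans (sum-cong-≗ (λ v → sym (eq (u , v)))) (regularᵁ u)
    ; regularⱽ = λ v → trans (sum-cong-≗ (λ u → sym (eq (u , v)))) (regularⱽ v) }
  ; L≤d = let ℓ , isLℓ , ℓ≤d = L≤d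
              M , planar , len = IsL.attained isLℓ
          in ℓ , record { attained = M , planar-resp eq planar , len
                        ; maximal = λ M planar → IsL.maximal isLℓ M (planar-resp (sym ∘ eq) planar) } , ℓ≤d
  }
  where
  open InG inG
  open IsRegular regular
  planar-resp : ∀ {n} {G G′ : Multigraph n} {M} → G ≗ G′ → IsPlanarMatching G M → IsPlanarMatching G′ M
  planar-resp eq planar = record
    { edges = All.map (λ {e} → subst (1 ≤_) (eq e)) edges ; noncrossing = noncrossing }
    where open IsPlanarMatching planar

isRegular? : ∀ {n} r (G : Multigraph n) → Dec (IsRegular r G)
isRegular? r G = map′
  (λ (regᵁ , regⱽ) → record { regularᵁ = regᵁ ; regularⱽ = regⱽ })
  (λ reg → IsRegular.regularᵁ reg , IsRegular.regularⱽ reg)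
  (Fin.all? (λ u → degreeᵁ G u ≟ r) ×-dec Fin.all? (λ v → degreeⱽ G v ≟ r))

inG-width : ∀ {n r d} {G : Multigraph n} → IsRegular r G → (F : Configuration n r) →
            (∀ x → Joined G x (Inverse.to F x)) → width (σ F) ≤ d → InG r d G
inG-width {G = G} reg F joined w≤d = record { regular = reg ; L≤d = width (σ F) , isL {G = G} reg F joined , w≤d }

-- For a regular `G` no search over matchings takes place: by `isL` the bound on `L(G)` is a bound
-- on the width of the configuration built from `G`.
inG? : ∀ {n} r d (G : Multigraph n) → Dec (InG r d G)
inG? {n} r d G with isRegular? r G
... | no ¬reg = no λ inG → ¬reg (InG.regular inG)
... | yes reg = let F , joined = configuration {n} {r} {G} reg in
  map′ {A = width (σ F) ≤ d} (inG-width {G = G} reg F joined) (λ inG → isL-width-≤ {G = G} inG F joined) (width (σ F) ≤? d)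

subset-finite : ∀ {N p} {P : Fin N → Set p} → (∀ i → Dec (P i)) → ∃ (HasCardinality (Subset (setoid (Fin N)) P))
subset-finite {N} {P = P} P? = length xs , record
  { to        = to
  ; from      = from
  ; to-cong   = λ {x} {y} → to-unique x y
  ; from-cong = λ { refl → refl }
  ; inverse   = (λ {j} {x} eq → lookup-injective unique (trans (to-lookup x) eq))
              , (λ { {x} refl → to-lookup x })
  }
  where
  xs : List (Fin N)
  xs = filter P? (allFin N)
  unique : Unique xs
  unique = Unique.filter⁺ P? (Unique.allFin⁺ N)
  member : (x : Σ (Fin N) P) → proj₁ x ∈ xs
  member (i , p) = ∈.∈-filter⁺ P? (∈.∈-allFin i) p
  to : Σ (Fin N) P → Fin (length xs)
  to x = index (member x)
  to-lookup : ∀ x → lookup xs (to x) ≡ proj₁ x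
  to-lookup x = sym (Any.lookup-index (member x))
  to-unique : ∀ x y → proj₁ x ≡ proj₁ y → to x ≡ to y
  to-unique x y eq = lookup-injective unique (trans (to-lookup x) (trans eq (sym (to-lookup y))))
  from : Fin (length xs) → Σ (Fin N) P
  from j = lookup xs j , proj₂ (∈.∈-filter⁻ P? {xs = allFin N} (∈.∈-lookup j))

funToFin-cong : ∀ {m n} {f g : Fin m → Fin n} → f ≗ g → Fin.funToFin f ≡ Fin.funToFin g
funToFin-cong {zero}  eq = refl
funToFin-cong {suc m} eq = cong₂ combine (eq Fin.zero) (funToFin-cong (eq ∘ Fin.suc))

≤-sum : ∀ {n} (g : Fin n → ℕ) v → g v ≤ sum g
≤-sum g v = ≤-trans (m≤n+m (g v) (later g v)) (cell-bound g v)

-- Regularity bounds each multiplicity by `r`, so a multigraph is coded as a function from `n * n`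
-- positions to `Fin (suc r)`, and these functions as numbers below `suc r ^ (n * n)`. The codes of
-- members form a decidable subset.
𝒢-finite : ∀ n r d → ∃ (HasCardinality (𝒢 n r d))
𝒢-finite n r d = let g , finite = subset-finite (inG? r d ∘ decode) in g , inverse-∘ coding finite
  where
  Code : Set
  Code = Fin (suc r ^ (n * n))
  decode : Code → Multigraph n
  decode c (u , v) = toℕ (Fin.finToFun {suc r} {n * n} c (combine u v))
  bounded : ∀ {G} → InG r d G → ∀ e → G e < suc r
  bounded {G} inG (u , v) = s≤s (≤-trans (≤-sum (λ v → G (u , v)) v) (≤-reflexive (IsRegular.regularᵁ (InG.regular inG) u)))
  encode : Σ (Multigraph n) (InG r d) → Code
  encode (G , inG) = Fin.funToFin (λ i → fromℕ< (bounded inG (remQuot n i)))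
  encode-cong : ∀ x y → proj₁ x ≗ proj₁ y → encode x ≡ encode y
  encode-cong x y eq = funToFin-cong λ i → Fin.fromℕ<-cong _ _ (eq (remQuot n i)) _ _
  decode-encode : ∀ x → decode (encode x) ≗ proj₁ x
  decode-encode (G , inG) (u , v) = begin
    toℕ (Fin.finToFun (encode (G , inG)) (combine u v))             ≡⟨ cong toℕ (Fin.finToFun-funToFin _ (combine u v)) ⟩
    toℕ (fromℕ< (bounded inG (remQuot n (combine u v))))            ≡⟨ Fin.toℕ-fromℕ< _ ⟩
    G (remQuot n (combine u v))                                     ≡⟨ cong G (Fin.remQuot-combine u v) ⟩
    G (u , v)                                                       ∎
    where open ≡-Reasoning
  encode-decode : ∀ c inG → encode (decode c , inG) ≡ c
  encode-decode c inG = trans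
    (funToFin-cong λ i → Fin.toℕ-injective (trans (Fin.toℕ-fromℕ< _)
      (cong (toℕ ∘ Fin.finToFun {suc r} {n * n} c) (Fin.combine-remQuot {n} n i))))
    (Fin.funToFin-finToFin {n * n} {suc r} c)
  coding : Inverse (𝒢 n r d) (Subset (setoid Code) (InG r d ∘ decode))
  coding = record
    { to        = λ x → encode x , inG-resp (sym ∘ decode-encode x) (proj₂ x)
    ; from      = λ (c , inG) → decode c , inG
    ; to-cong   = λ {x} {y} → encode-cong x y
    ; from-cong = λ { refl _ → refl }
    ; inverse   = (λ {y} {x} eq → trans (encode-cong x (decode (proj₁ y) , proj₂ y) eq) (encode-decode (proj₁ y) (proj₂ y)))
                , (λ { {x} refl → decode-encode x })
    }

theorem5 : (n r d : ℕ) .{{_ : NonZero n}} .{{_ : NonZero r}} →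
    (Σ[ b ∈ Bijection (𝒢̄ n r d) (TableauPairs n r d) ]
    (∀ F → proj₁ (Bijection.to b F) ≡ RSK (σ (proj₁ F))))
    × (∃[ g ] (HasCardinality (𝒢 n r d) g × HasCardinality (TableauPairs n r d) g))
theorem5 n r d = (RSK-bijection n r d , λ _ → refl)
  , let g , finite = 𝒢-finite n r d in
    g , finite , inverse-∘ (inverse-sym (Bijection⇒Inverse (RSK-bijection n r d)))
                           (inverse-∘ (inverse-sym (𝒢↔𝒢̄ n r d)) finite)
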